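{- Let $W=\{(l_i,b_i,p_i,\epsilon_i,k_i,\mu_i)\}_{i=1}^{\infty}$ be a BFF and let $\{x_i\}_{i=1}^{\infty}$ be a $W$-good sequence. Let $L_i=\sum_{j=1}^i l_j|x_j|$ (with $L_0=0$), let $q_n=b_i$ for $L_{i-1}<n\le L_i$, let $Q=\{q_n\}_{n=1}^\infty$, let $(E_1,E_2,\ldots)=l_1x_1\,l_2x_2\,l_3x_3\ldots$, and let $x=\sum_{n=1}^{\infty}\frac{E_n}{q_1q_2\cdots q_n}$. If $k\in R(W)$, then $x$ is $Q$-normal of order $k$. If $k_i\to\infty$, then $x$ is $Q$-normal.
   Context: Blocks. A block of length $k$ in base $b$ is an ordered $k$-tuple of integers in $\{0,1,\ldots,b-1\}$; a block is a block of some length in some base. $|B|$ is the length of $B$. For blocks $B_1,B_2,\ldots$ and non-negative integers $l_1,l_2,\ldots$, $l_1B_1\,l_2B_2\ldots$ denotes the concatenation of $l_1$ copies of $B_1$, then $l_2$ copies of $B_2$, and so on. For blocks $B,y$, $N_n(B,y)$ is the number of occurrences of $B$ in $y$ (as consecutive entries) with starting position at most $n$. Cantor series. A basic sequence is a sequence $Q=\{q_n\}_{n\ge1}$ of integers $q_n\ge2$. The $Q$-Cantor series expansion of a real $x\in[0,1)$ is the unique expansion $x=\sum_{n\ge1}\frac{E_n}{q_1\cdots q_n}$ with $E_n\in\{0,\ldots,q_n-1\}$ and $E_n\ne q_n-1$ infinitely often. $N_n^Q(B,x)$ is the number of times the block $B$ occurs starting at a position no greater than $n$ in the $Q$-Cantor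 series expansion of $x$. $Q_n^{(k)}=\sum_{j=1}^n\frac{1}{q_jq_{j+1}\cdots q_{j+k-1}}$. A real number $x$ is $Q$-normal of order $k$ if $\lim_{n\to\infty}N_n^Q(B,x)/Q_n^{(k)}=1$ for all blocks $B$ of length $k$ (in any base), and $Q$-normal if it is $Q$-normal of order $k$ for all $k$. Weightings. A weighting $\mu$ is a collection of functions $\mu^{(k)}:\{0,1,2,\ldots\}^k\to[0,1]$, $k\ge1$, with $\sum_{j=0}^\infty\mu^{(1)}(j)=1$ and $\mu^{(k)}(b_1,\ldots,b_k)=\sum_{j=0}^\infty\mu^{(k+1)}(b_1,\ldots,b_k,j)$ for all $k$. For integers $1\le p\le b$, $\mu$ is $(p,b)$-uniform if $\mu^{(k)}(B)=b^{ -k}$ for all $k$ and all blocks $B$ of length $k$ in base $p$. For $0<\epsilon<1$, a positive integer $k$ and a weighting $\mu$, a block $y$ is $(\epsilon,k,\mu)$-normal if for all blocks $B$ of length $m\le k$, $\mu^{(m)}(B)|y|(1-\epsilon)\le N_{|y|}(B,y)\le\mu^{(m)}(B)|y|(1+\epsilon)$. BFF. A BFF (block friendly family) is a sequence of $6$-tuples $W=\{(l_i,b_i,p_i,\epsilon_i,k_i,\mu_i)\}_{i\ge1}$ where $\{l_i\},\{b_i\},\{p_i\},\{k_i\}$ are non-decreasing sequences of non-negative integers with $b_i\ge2$, $b_i\to\infty$ and $p_i\to\infty$; $\{\mu_i\}$ is a sequence of $(p_i,b_i)$-uniform weightings; and $\{\epsilon_i\}$ strictly decreases to $0$. $R(W)=\{0,1,\ldots,K\}$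 if $\lim k_i=K<\infty$, and $R(W)=\{0,1,2,\ldots\}$ otherwise. $W$-good. A sequence of blocks $\{x_i\}_{i\ge1}$ with $|x_i|$ non-decreasing and each $x_i$ being $(\epsilon_i,k_i,\mu_i)$-normal is $W$-good if for every $k\in R(W)$, as $i\to\infty$: (1) $|x_i|\Big/\frac{b_i^k}{\epsilon_{i-1}-\epsilon_i}\to\infty$; (2) $\frac{l_{i-1}}{l_i}\cdot\frac{|x_{i-1}|}{|x_i|}=o(i^{ -1}b_i^{ -k})$; (3) $\frac1{l_i}\cdot\frac{|x_{i+1}|}{|x_i|}=o(b_i^{ -k})$.
   Formalization: The digits are assumed to satisfy E_n < q_n for all n (otherwise carries can destroy normality), and for order k = 0 the existence of a Q-Cantor series expansion of x is not claimed (x may equal 1). -}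

module Defs where

open import Data.Nat as ℕ using (ℕ; zero; suc; NonZero)
import Data.Nat.Properties as ℕₚ
open import Data.Integer using (+_)
open import Data.Rational as ℚ using (ℚ; 0ℚ; 1ℚ; ½; ∣_∣)
import Data.Rational.Properties as ℚₚ
open import Data.Rational.Solver using (module +-*-Solver)
open import Data.Bool using (if_then_else_)
open import Data.List using (List; []; _++_; take; drop; length; concat; replicate; applyUpTo)
open import Data.List.Properties using (≡-dec)
open import Data.Vec using (Vec; toList; _∷ʳ_; _∷_; [])
open import Data.Vec.Relation.Unary.All using (All)
open import Data.Product using (Σ-syntax; ∃-syntax; _×_; _,_)
open import Data.Sum using (_⊎_)
open import Relation.Nullary using (does)
open import Relation.Unary using (Pred; Decidable)
open import Relation.Binary.PropositionalEquality using (_≡_; _≢_; refl; sym; trans; cong; subst)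
open import Level using (0ℓ)

-- Every sequence is indexed from 0: term n of a sequence here is term n + 1 of
-- the corresponding sequence indexed from 1.

Eventually : Pred ℕ 0ℓ → Set
Eventually P = ∃[ N ] (∀ n → N ℕ.≤ n → P n)

-- Real numbers: rational Cauchy sequences, compared with _≤ᴿ_, _<ᴿ_ and _≃ᴿ_.

record ℝ : Set where
  constructor mkℝ
  field
    approx : ℕ → ℚ
    cauchy : ∀ δ → 0ℚ ℚ.< δ →
             ∃[ N ] (∀ m n → N ℕ.≤ m → N ℕ.≤ n → ∣ approx m ℚ.- approx n ∣ ℚ.< δ)

open ℝ public

infix  4 _≤ᴿ_ _<ᴿ_ _≃ᴿ_
infixl 6 _+ᴿ_ _-ᴿ_
infixl 7 _*ᴿ_
infix  8 -ᴿ_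

_≤ᴿ_ : ℝ → ℝ → Set
x ≤ᴿ y = ∀ δ → 0ℚ ℚ.< δ → Eventually (λ n → approx x n ℚ.≤ approx y n ℚ.+ δ)

_<ᴿ_ : ℝ → ℝ → Set
x <ᴿ y = ∃[ δ ] (0ℚ ℚ.< δ × Eventually (λ n → approx x n ℚ.+ δ ℚ.≤ approx y n))

_≃ᴿ_ : ℝ → ℝ → Set
x ≃ᴿ y = x ≤ᴿ y × y ≤ᴿ x

private
  0<δ/2 : ∀ {δ} → 0ℚ ℚ.< δ → 0ℚ ℚ.< δ ℚ.* ½
  0<δ/2 {δ} 0<δ = ℚₚ.positive⁻¹ _ {{ℚₚ.pos*pos⇒pos δ {{ℚ.positive 0<δ}} ½}}

  halves : ∀ δ → δ ℚ.* ½ ℚ.+ δ ℚ.* ½ ≡ δ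
  halves δ = trans (sym (ℚₚ.*-distribˡ-+ δ ½ ½)) (ℚₚ.*-identityʳ δ)

  module S = +-*-Solver

  +-split : ∀ a b c d → (a ℚ.+ b) ℚ.- (c ℚ.+ d) ≡ (a ℚ.- c) ℚ.+ (b ℚ.- d)
  +-split = S.solve 4 (λ a b c d → (a S.:+ b) S.:- (c S.:+ d) S.:= (a S.:- c) S.:+ (b S.:- d)) refl

  neg-split : ∀ a b → (ℚ.- a) ℚ.- (ℚ.- b) ≡ ℚ.- (a ℚ.- b)
  neg-split = S.solve 2 (λ a b → (S.:- a) S.:- (S.:- b) S.:= S.:- (a S.:- b)) refl

  *-split : ∀ a b c d → a ℚ.* b ℚ.- c ℚ.* d ≡ a ℚ.* (b ℚ.- d) ℚ.+ d ℚ.* (a ℚ.- c)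
  *-split = S.solve 4 (λ a b c d → a S.:* b S.:- c S.:* d S.:= a S.:* (b S.:- d) S.:+ d S.:* (a S.:- c)) refl

  recentre : ∀ a b → a ≡ (a ℚ.- b) ℚ.+ b
  recentre = S.solve 2 (λ a b → a S.:= (a S.:- b) S.:+ b) refl

  assoc-swap : ∀ c δ i → c ℚ.* (δ ℚ.* i) ≡ δ ℚ.* (c ℚ.* i)
  assoc-swap = S.solve 3 (λ c δ i → c S.:* (δ S.:* i) S.:= δ S.:* (c S.:* i)) refl

  bounded : ∀ x → ∃[ C ] (0ℚ ℚ.< C × Eventually (λ n → ∣ approx x n ∣ ℚ.≤ C))
  bounded x with cauchy x 1ℚ (ℚₚ.positive⁻¹ 1ℚ)
  ... | N , close = 1ℚ ℚ.+ ∣ approx x N ∣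
                  , ℚₚ.+-mono-<-≤ (ℚₚ.positive⁻¹ 1ℚ) (ℚₚ.0≤∣p∣ (approx x N))
                  , N , λ n N≤n →
    let open ℚₚ.≤-Reasoning in begin
      ∣ approx x n ∣
        ≡⟨ cong ∣_∣ (recentre (approx x n) (approx x N)) ⟩
      ∣ (approx x n ℚ.- approx x N) ℚ.+ approx x N ∣
        ≤⟨ ℚₚ.∣p+q∣≤∣p∣+∣q∣ (approx x n ℚ.- approx x N) (approx x N) ⟩
      ∣ approx x n ℚ.- approx x N ∣ ℚ.+ ∣ approx x N ∣
        ≤⟨ ℚₚ.+-monoˡ-≤ ∣ approx x N ∣ (ℚₚ.<⇒≤ (close n N N≤n ℕₚ.≤-refl)) ⟩
      1ℚ ℚ.+ ∣ approx x N ∣ ∎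

  scale : ∀ {δ C} → 0ℚ ℚ.< δ → 0ℚ ℚ.< C → ∃[ η ] (0ℚ ℚ.< η × C ℚ.* η ≡ δ)
  scale {δ} {C} 0<δ 0<C =
    δ ℚ.* C⁻¹ ,
    ℚₚ.positive⁻¹ _ {{ℚₚ.pos*pos⇒pos δ {{ℚ.positive 0<δ}} C⁻¹ {{ℚₚ.1/pos⇒pos C}}}} ,
    trans (assoc-swap C δ C⁻¹) (trans (cong (δ ℚ.*_) (ℚₚ.*-inverseʳ C)) (ℚₚ.*-identityʳ δ))
    where
      instance
        C-pos = ℚ.positive 0<C
        C-nz  = ℚₚ.pos⇒nonZero C
      C⁻¹ = ℚ.1/ C

  prod-bound : ∀ {C η} a b → 0ℚ ℚ.< C → ∣ a ∣ ℚ.≤ C → ∣ b ∣ ℚ.< η → ∣ a ℚ.* b ∣ ℚ.< C ℚ.* η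
  prod-bound {C} {η} a b 0<C a≤C b<η = let open ℚₚ.≤-Reasoning in begin-strict
    ∣ a ℚ.* b ∣     ≡⟨ ℚₚ.∣p*q∣≡∣p∣*∣q∣ a b ⟩
    ∣ a ∣ ℚ.* ∣ b ∣ ≤⟨ ℚₚ.*-monoʳ-≤-nonNeg ∣ b ∣ {{ℚₚ.∣-∣-nonNeg b}} a≤C ⟩
    C ℚ.* ∣ b ∣     <⟨ ℚₚ.*-monoʳ-<-pos C {{ℚ.positive 0<C}} b<η ⟩
    C ℚ.* η         ∎

fromℚ : ℚ → ℝ
fromℚ r = mkℝ (λ _ → r) (λ δ 0<δ → 0 , λ _ _ _ _ →
  subst (ℚ._< δ) (sym (cong ∣_∣ (ℚₚ.+-inverseʳ r))) 0<δ)

fromℕ : ℕ → ℝ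
fromℕ n = fromℚ (+ n ℚ./ 1)

0ᴿ 1ᴿ : ℝ
0ᴿ = fromℚ 0ℚ
1ᴿ = fromℚ 1ℚ

_+ᴿ_ : ℝ → ℝ → ℝ
x +ᴿ y = mkℝ (λ n → approx x n ℚ.+ approx y n) λ δ 0<δ →
  let Nx , closex = cauchy x (δ ℚ.* ½) (0<δ/2 0<δ)
      Ny , closey = cauchy y (δ ℚ.* ½) (0<δ/2 0<δ)
      open ℚₚ.≤-Reasoning
  in Nx ℕ.⊔ Ny , λ m n N≤m N≤n → begin-strict
    ∣ (approx x m ℚ.+ approx y m) ℚ.- (approx x n ℚ.+ approx y n) ∣
      ≡⟨ cong ∣_∣ (+-split (approx x m) (approx y m) (approx x n) (approx y n)) ⟩
    ∣ (approx x m ℚ.- approx x n) ℚ.+ (approx y m ℚ.- approx y n) ∣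
      ≤⟨ ℚₚ.∣p+q∣≤∣p∣+∣q∣ (approx x m ℚ.- approx x n) (approx y m ℚ.- approx y n) ⟩
    ∣ approx x m ℚ.- approx x n ∣ ℚ.+ ∣ approx y m ℚ.- approx y n ∣
      <⟨ ℚₚ.+-mono-< (closex m n (ℕₚ.m⊔n≤o⇒m≤o Nx Ny N≤m) (ℕₚ.m⊔n≤o⇒m≤o Nx Ny N≤n))
                     (closey m n (ℕₚ.m⊔n≤o⇒n≤o Nx Ny N≤m) (ℕₚ.m⊔n≤o⇒n≤o Nx Ny N≤n)) ⟩
    δ ℚ.* ½ ℚ.+ δ ℚ.* ½
      ≡⟨ halves δ ⟩
    δ ∎

-ᴿ_ : ℝ → ℝ
-ᴿ x = mkℝ (λ n → ℚ.- approx x n) λ δ 0<δ →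
  let N , close = cauchy x δ 0<δ
  in N , λ m n N≤m N≤n → subst (ℚ._< δ)
       (sym (trans (cong ∣_∣ (neg-split (approx x m) (approx x n)))
                   (ℚₚ.∣-p∣≡∣p∣ (approx x m ℚ.- approx x n))))
       (close m n N≤m N≤n)

_-ᴿ_ : ℝ → ℝ → ℝ
x -ᴿ y = x +ᴿ (-ᴿ y)

_*ᴿ_ : ℝ → ℝ → ℝ
x *ᴿ y = mkℝ (λ n → approx x n ℚ.* approx y n) λ δ 0<δ →
  let A , 0<A , Na , bdx = bounded x
      B , 0<B , Nb , bdy = bounded y
      α , 0<α , Aα≡      = scale (0<δ/2 0<δ) 0<A
      β , 0<β , Bβ≡      = scale (0<δ/2 0<δ) 0<B
      Ny , closey        = cauchy y α 0<α
      Nx , closex        = cauchy x β 0<β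
      L = Na ℕ.⊔ Nb
      M = Nx ℕ.⊔ Ny
      open ℚₚ.≤-Reasoning
      a≤ = λ {n} (p : L ℕ.⊔ M ℕ.≤ n) → ℕₚ.m⊔n≤o⇒m≤o Na Nb (ℕₚ.m⊔n≤o⇒m≤o L M p)
      b≤ = λ {n} (p : L ℕ.⊔ M ℕ.≤ n) → ℕₚ.m⊔n≤o⇒n≤o Na Nb (ℕₚ.m⊔n≤o⇒m≤o L M p)
      x≤ = λ {n} (p : L ℕ.⊔ M ℕ.≤ n) → ℕₚ.m⊔n≤o⇒m≤o Nx Ny (ℕₚ.m⊔n≤o⇒n≤o L M p)
      y≤ = λ {n} (p : L ℕ.⊔ M ℕ.≤ n) → ℕₚ.m⊔n≤o⇒n≤o Nx Ny (ℕₚ.m⊔n≤o⇒n≤o L M p)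
  in L ℕ.⊔ M , λ m n N≤m N≤n →
    let xm = approx x m
        ym = approx y m
        xn = approx x n
        yn = approx y n
    in begin-strict
    ∣ xm ℚ.* ym ℚ.- xn ℚ.* yn ∣
      ≡⟨ cong ∣_∣ (*-split xm ym xn yn) ⟩
    ∣ xm ℚ.* (ym ℚ.- yn) ℚ.+ yn ℚ.* (xm ℚ.- xn) ∣
      ≤⟨ ℚₚ.∣p+q∣≤∣p∣+∣q∣ (xm ℚ.* (ym ℚ.- yn)) (yn ℚ.* (xm ℚ.- xn)) ⟩
    ∣ xm ℚ.* (ym ℚ.- yn) ∣ ℚ.+ ∣ yn ℚ.* (xm ℚ.- xn) ∣
      <⟨ ℚₚ.+-mono-<
           (prod-bound xm (ym ℚ.- yn) 0<A (bdx m (a≤ N≤m)) (closey m n (y≤ N≤m) (y≤ N≤n)))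
           (prod-bound yn (xm ℚ.- xn) 0<B (bdy n (b≤ N≤n)) (closex m n (x≤ N≤m) (x≤ N≤n))) ⟩
    A ℚ.* α ℚ.+ B ℚ.* β
      ≡⟨ trans (cong (ℚ._+ B ℚ.* β) Aα≡) (cong (δ ℚ.* ½ ℚ.+_) Bβ≡) ⟩
    δ ℚ.* ½ ℚ.+ δ ℚ.* ½
      ≡⟨ halves δ ⟩
    δ ∎

infix 4 _⟶_ _⟶∞

_⟶_ : (ℕ → ℝ) → ℝ → Set
s ⟶ x = ∀ δ → 0ℚ ℚ.< δ →
        Eventually (λ n → s n ≤ᴿ x +ᴿ fromℚ δ × x ≤ᴿ s n +ᴿ fromℚ δ)

_⟶∞ : (ℕ → ℕ) → Set
s ⟶∞ = ∀ M → Eventually (λ n → M ℕ.≤ s n)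

Σᴿ : ℕ → (ℕ → ℝ) → ℝ
Σᴿ zero    f = 0ᴿ
Σᴿ (suc n) f = Σᴿ n f +ᴿ f n

_sumsTo_ : (ℕ → ℝ) → ℝ → Set
f sumsTo x = (λ n → Σᴿ n f) ⟶ x

Σℚ : ℕ → (ℕ → ℚ) → ℚ
Σℚ zero    f = 0ℚ
Σℚ (suc n) f = Σℚ n f ℚ.+ f n

∏ : ℕ → (ℕ → ℕ) → ℕ
∏ zero    f = 1
∏ (suc n) f = ∏ n f ℕ.* f n

-- The value at 0 is a placeholder: recip is only applied to products of
-- positive numbers.
recip : ℕ → ℚ
recip zero    = 0ℚ
recip (suc n) = + 1 ℚ./ suc n

-- A block is a finite list of natural numbers (every such list is a block in
-- some base); Vec ℕ k is the type of blocks of length k.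
Block : Set
Block = List ℕ

InBase : ∀ {k} → ℕ → Vec ℕ k → Set
InBase b B = All (ℕ._< b) B

count : {P : Pred ℕ 0ℓ} → Decidable P → ℕ → ℕ
count P? zero    = 0
count P? (suc n) = count P? n ℕ.+ (if does (P? n) then 1 else 0)

OccursAt : ∀ {k} → Vec ℕ k → Block → Pred ℕ 0ℓ
OccursAt {k} B y j = take k (drop j y) ≡ toList B

occursAt? : ∀ {k} (B : Vec ℕ k) (y : Block) → Decidable (OccursAt B y)
occursAt? B y j = ≡-dec ℕ._≟_ _ _

-- N_n(B , y)
N : ∀ {k} → ℕ → Vec ℕ k → Block → ℕ
N n B y = count (occursAt? B y) n

OccursAtω : ∀ {k} → Vec ℕ k → (ℕ → ℕ) → Pred ℕ 0ℓ
OccursAtω {k} B F j = applyUpTo (λ t → F (j ℕ.+ t)) k ≡ toList B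

occursAtω? : ∀ {k} (B : Vec ℕ k) (F : ℕ → ℕ) → Decidable (OccursAtω B F)
occursAtω? B F j = ≡-dec ℕ._≟_ _ _

-- The same count for the infinite digit sequence F.
Nω : ∀ {k} → ℕ → Vec ℕ k → (ℕ → ℕ) → ℕ
Nω n B F = count (occursAtω? B F) n

record BasicSequence : Set where
  field
    q   : ℕ → ℕ
    2≤q : ∀ n → 2 ℕ.≤ q n

open BasicSequence public

cantorTerm : BasicSequence → (ℕ → ℕ) → ℕ → ℝ
cantorTerm Q E n = fromℚ ((+ E n ℚ./ 1) ℚ.* recip (∏ (suc n) (q Q)))

record IsCantorExpansion (Q : BasicSequence) (x : ℝ) (F : ℕ → ℕ) : Set where
  field
    digits  : ∀ n → F n ℕ.< q Q n
    notLast : ∀ n → ∃[ m ] (n ℕ.≤ m × F m ≢ q Q m ℕ.∸ 1)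
    value   : cantorTerm Q F sumsTo x

-- Q_n^(k)
Qsum : BasicSequence → (k n : ℕ) → ℚ
Qsum Q k n = Σℚ n (λ j → recip (∏ k (λ t → q Q (j ℕ.+ t))))

RatioTendsTo1 : (ℕ → ℕ) → (ℕ → ℚ) → Set
RatioTendsTo1 a c = ∀ δ → 0ℚ ℚ.< δ → Eventually λ n →
  Σ[ nz ∈ ℚ.NonZero (c n) ] ∣ ((+ a n ℚ./ 1) ℚ.÷ c n) {{nz}} ℚ.- 1ℚ ∣ ℚ.≤ δ

-- The expansion of a real is unique when it exists, so the frequency condition
-- may be imposed on every expansion.  Its existence is required separately, for
-- positive order only: order 0 concerns the empty block, which occurs n times up
-- to position n in any sequence, so that the condition says nothing about the
-- digits and is retained even for a sum of digits all but finitely many of which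
-- are q_n − 1.
record NormalOfOrder (Q : BasicSequence) (k : ℕ) (x : ℝ) : Set where
  field
    expandable : 1 ℕ.≤ k → ∃[ F ] IsCantorExpansion Q x F
    frequency  : ∀ F → IsCantorExpansion Q x F → (B : Vec ℕ k) →
                 RatioTendsTo1 (λ n → Nω n B F) (Qsum Q k)

Normal : BasicSequence → ℝ → Set
Normal Q x = ∀ k → NormalOfOrder Q k x

-- weight k is μ^(k+1), as μ^(k) is only defined for k ≥ 1.
record Weighting : Set where
  field
    weight     : ∀ k → Vec ℕ (suc k) → ℝ
    nonneg     : ∀ k B → 0ᴿ ≤ᴿ weight k B
    atMost1    : ∀ k B → weight k B ≤ᴿ 1ᴿ
    total      : (λ j → weight 0 (j ∷ [])) sumsTo 1ᴿ
    consistent : ∀ k B → (λ j → weight (suc k) (B ∷ʳ j)) sumsTo weight k B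

open Weighting public

record Uniform (p b : ℕ) (μ : Weighting) : Set where
  field
    1≤p     : 1 ℕ.≤ p
    p≤b     : p ℕ.≤ b
    uniform : ∀ k (B : Vec ℕ (suc k)) → InBase p B →
              weight μ k B ≃ᴿ fromℚ (recip (b ℕ.^ suc k))

-- (ε , k , μ)-normality; blocks have length m + 1 ≤ k.
NormalBlock : ℝ → ℕ → Weighting → Block → Set
NormalBlock ε k μ y = ∀ m → suc m ℕ.≤ k → (B : Vec ℕ (suc m)) →
  weight μ m B *ᴿ fromℕ (length y) *ᴿ (1ᴿ -ᴿ ε) ≤ᴿ fromℕ (N (length y) B y) ×
  fromℕ (N (length y) B y) ≤ᴿ weight μ m B *ᴿ fromℕ (length y) *ᴿ (1ᴿ +ᴿ ε)

NonDecreasing : (ℕ → ℕ) → Set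
NonDecreasing s = ∀ i → s i ℕ.≤ s (suc i)

record BFF : Set where
  field
    l b p k : ℕ → ℕ
    ε       : ℕ → ℝ
    μ       : ℕ → Weighting
    l-mono  : NonDecreasing l
    b-mono  : NonDecreasing b
    p-mono  : NonDecreasing p
    k-mono  : NonDecreasing k
    2≤b     : ∀ i → 2 ℕ.≤ b i
    b⟶∞     : b ⟶∞
    p⟶∞     : p ⟶∞
    μ-unif  : ∀ i → Uniform (p i) (b i) (μ i)
    ε-decr  : ∀ i → ε (suc i) <ᴿ ε i
    ε⟶0     : ε ⟶ 0ᴿ

-- Membership in R(W).  A convergent sequence of naturals is eventually constant,
-- and the non-decreasing sequence k either converges or tends to infinity.
infix 4 _∈R_
_∈R_ : ℕ → BFF → Set
j ∈R W = (∃[ K ] (Eventually (λ i → BFF.k W i ≡ K) × j ℕ.≤ K)) ⊎ (BFF.k W ⟶∞)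

-- a / c = o(g), including that the quotient is eventually defined.
QuotientLittleO : (a c : ℕ → ℕ) → (ℕ → ℚ) → Set
QuotientLittleO a c g = ∀ δ → 0ℚ ℚ.< δ → Eventually λ i →
  Σ[ nz ∈ NonZero (c i) ] ((+ a i) ℚ./ c i) {{nz}} ℚ.≤ δ ℚ.* g i

-- In growth and ratio₁ the pair (i , suc i) stands for the one-based indices
-- (i + 1 , i + 2); this is where the factor 2 + i comes from.  In growth the
-- denominators, which are positive, are cleared.
record Good (W : BFF) (x : ℕ → Block) : Set where
  open BFF W
  field
    length-mono : NonDecreasing (λ i → length (x i))
    normal      : ∀ i → NormalBlock (ε i) (k i) (μ i) (x i)
    growth      : ∀ j → j ∈R W → ∀ M → Eventually λ i →
                  fromℕ (M ℕ.* b (suc i) ℕ.^ j)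
                    ≤ᴿ fromℕ (length (x (suc i))) *ᴿ (ε i -ᴿ ε (suc i))
    ratio₁      : ∀ j → j ∈R W → QuotientLittleO
                    (λ i → l i ℕ.* length (x i))
                    (λ i → l (suc i) ℕ.* length (x (suc i)))
                    (λ i → recip ((2 ℕ.+ i) ℕ.* b (suc i) ℕ.^ j))
    ratio₂      : ∀ j → j ∈R W → QuotientLittleO
                    (λ i → length (x (suc i)))
                    (λ i → l i ℕ.* length (x i))
                    (λ i → recip (b i ℕ.^ j))

-- L_i
L : BFF → (ℕ → Block) → ℕ → ℕ
L W x zero    = 0
L W x (suc i) = L W x i ℕ.+ BFF.l W i ℕ.* length (x i)

-- The concatenation l₁x₁ … l_i x_i, a block of length L_i.
word : BFF → (ℕ → Block) → ℕ → Block
word W x zero    = []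
word W x (suc i) = word W x i ++ concat (replicate (BFF.l W i) (x i))

{-# OPTIONS --safe #-}
-- Compare the number A(n) of occurrences of a block of length k ≥ 1 with
-- C(n) = Q_n^(k) along the copies of the x_i.  For large i, every copy adds
-- |x_i| b_i^(-k) to each of A and C, up to a small relative error: for A by the
-- normality of x_i, and in both cases the k windows that leave the copy are
-- negligible against |x_i| b_i^(-k) by the growth condition.  At a general n one
-- incomplete copy remains; it contributes at most |x_i|, which is negligible
-- against l_(i-1) |x_(i-1)| b_(i-1)^(-k) by the second ratio condition.  The digit
-- 0 recurs, so the given digits form a Cantor expansion, and two such expansions
-- of one real agree because a first difference leaves a gap that never closes.
module Submission where

open import Defs
open import Data.Nat as ℕ using (ℕ; zero; suc; _≤_; _<_; NonZero)
import Data.Nat.Properties as ℕₚ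
open import Data.Nat.DivMod using (_/_; _%_; m≡m%n+[m/n]*n; m%n<n)
open import Data.Nat.Induction using (<-rec)
open import Data.Integer as ℤ using (+_)
import Data.Integer.Properties as ℤₚ
open import Data.Rational as ℚ using (ℚ; 0ℚ; 1ℚ; ½; ∣_∣; _÷_; 1/_)
import Data.Rational.Properties as ℚₚ
import Data.Rational.Unnormalised as ℚᵘ
import Data.Rational.Unnormalised.Properties as ℚᵘₚ
open import Data.Rational.Solver using (module +-*-Solver)
open import Data.Bool using (true; false; if_then_else_)
open import Data.Empty using (⊥)
open import Data.List using (List; []; _∷_; _++_; take; drop; length; concat; replicate; applyUpTo)
open import Data.List.Properties using (length-applyUpTo; length-take; length-drop; ∷-injective)
open import Data.Product using (Σ-syntax; ∃-syntax; _×_; _,_; proj₁; proj₂)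
open import Data.Sum using (_⊎_; inj₁; inj₂)
open import Data.Unit using (tt)
open import Data.Vec using (Vec; []; _∷_)
open import Data.Vec.Properties using (length-toList)
open import Data.Vec.Relation.Unary.All using ([]; _∷_)
open import Function using (_∘_)
open import Level using (0ℓ)
open import Relation.Binary.Definitions using (tri<; tri≈; tri>)
open import Relation.Binary.PropositionalEquality
open import Relation.Nullary using (yes; no; does; contradiction)
open import Relation.Unary using (Pred; Decidable)

-- Rational arithmetic

-- Hypotheses about reals are read off at a single index of the approximating sequences, with the
-- tolerance fixed beforehand, so that only rational inequalities remain. For a tolerance `e`,
-- normality of `x i` then costs a relative error `4e`, and a whole copy costs `12e`. Relative
-- errors of copies do not pile up: `θ` times the increments of `C` telescopes to `θ` times `C`. The
-- discrepancy before the threshold is a constant, absorbed once the blocks are longer than that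
-- initial segment. Initial segment, complete copies and incomplete copy each contribute `12e`,
-- which gives `36e` in all. Uniqueness of expansions enters because normality speaks of every
-- expansion of the real, whereas the structure of copies is given for one digit sequence only.

module S = +-*-Solver
open S using (_:+_; _:*_; _:-_; _:=_; con)

ι : ℕ → ℚ
ι n = + n ℚ./ 1

toℚᵘ-ι : ∀ n → ℚ.toℚᵘ (ι n) ℚᵘ.≃ ℚᵘ.mkℚᵘ (+ n) 0
toℚᵘ-ι n = ℚₚ.toℚᵘ-fromℚᵘ (ℚᵘ.mkℚᵘ (+ n) 0)

ι-+ : ∀ m n → ι (m ℕ.+ n) ≡ ι m ℚ.+ ι n
ι-+ m n = ℚₚ.toℚᵘ-injective (begin
  ℚ.toℚᵘ (ι (m ℕ.+ n))                     ≈⟨ toℚᵘ-ι (m ℕ.+ n) ⟩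
  ℚᵘ.mkℚᵘ (+ (m ℕ.+ n)) 0                  ≈⟨ ℚᵘ.*≡* (cong (ℤ._* + 1) (sym (cong₂ ℤ._+_ (ℤₚ.*-identityʳ (+ m)) (ℤₚ.*-identityʳ (+ n))))) ⟩
  ℚᵘ.mkℚᵘ (+ m) 0 ℚᵘ.+ ℚᵘ.mkℚᵘ (+ n) 0     ≈⟨ ℚᵘₚ.+-cong (toℚᵘ-ι m) (toℚᵘ-ι n) ⟨
  ℚ.toℚᵘ (ι m) ℚᵘ.+ ℚ.toℚᵘ (ι n)           ≈⟨ ℚₚ.toℚᵘ-homo-+ (ι m) (ι n) ⟨
  ℚ.toℚᵘ (ι m ℚ.+ ι n) ∎)
  where open ℚᵘₚ.≃-Reasoning

ι-* : ∀ m n → ι (m ℕ.* n) ≡ ι m ℚ.* ι n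
ι-* m n = ℚₚ.toℚᵘ-injective (begin
  ℚ.toℚᵘ (ι (m ℕ.* n))                     ≈⟨ toℚᵘ-ι (m ℕ.* n) ⟩
  ℚᵘ.mkℚᵘ (+ (m ℕ.* n)) 0                  ≈⟨ ℚᵘ.*≡* (cong (ℤ._* + 1) (ℤₚ.pos-* m n)) ⟩
  ℚᵘ.mkℚᵘ (+ m) 0 ℚᵘ.* ℚᵘ.mkℚᵘ (+ n) 0     ≈⟨ ℚᵘₚ.*-cong (toℚᵘ-ι m) (toℚᵘ-ι n) ⟨
  ℚ.toℚᵘ (ι m) ℚᵘ.* ℚ.toℚᵘ (ι n)           ≈⟨ ℚₚ.toℚᵘ-homo-* (ι m) (ι n) ⟨
  ℚ.toℚᵘ (ι m ℚ.* ι n) ∎)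
  where open ℚᵘₚ.≃-Reasoning

ι-mono : ∀ {m n} → m ℕ.≤ n → ι m ℚ.≤ ι n
ι-mono {m} {n} m≤n = ℚₚ.toℚᵘ-cancel-≤ (begin
  ℚ.toℚᵘ (ι m)     ≃⟨ toℚᵘ-ι m ⟩
  ℚᵘ.mkℚᵘ (+ m) 0  ≤⟨ ℚᵘ.*≤* (ℤₚ.*-monoʳ-≤-nonNeg (+ 1) (ℤ.+≤+ m≤n)) ⟩
  ℚᵘ.mkℚᵘ (+ n) 0  ≃⟨ toℚᵘ-ι n ⟨
  ℚ.toℚᵘ (ι n) ∎)
  where open ℚᵘₚ.≤-Reasoning

ι-cancel : ∀ {m n} → ι m ℚ.≤ ι n → m ℕ.≤ n
ι-cancel {m} {n} ιm≤ιn with ℕₚ.≤-total m n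
... | inj₁ m≤n = m≤n
... | inj₂ n≤m = ℕₚ.≤-reflexive (eq (ℚₚ.≤-antisym ιm≤ιn (ι-mono n≤m)))
  where
  eq : ι m ≡ ι n → m ≡ n
  eq e with ℚᵘₚ.≃-trans (ℚᵘₚ.≃-sym (toℚᵘ-ι m)) (ℚᵘₚ.≃-trans (ℚₚ.toℚᵘ-cong e) (toℚᵘ-ι n))
  ... | ℚᵘ.*≡* p = ℤₚ.+-injective (trans (sym (ℤₚ.*-identityʳ (+ m))) (trans p (ℤₚ.*-identityʳ (+ n))))

0≤ι : ∀ n → 0ℚ ℚ.≤ ι n
0≤ι n = ι-mono {0} {n} ℕ.z≤n

0<1 : 0ℚ ℚ.< 1ℚ
0<1 = ℚₚ.positive⁻¹ 1ℚ

/-*-cancel : ∀ m n .{{_ : NonZero n}} → (+ m ℚ./ n) ℚ.* ι n ≡ ι m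
/-*-cancel m n@(suc n-1) = ℚₚ.toℚᵘ-injective (begin
  ℚ.toℚᵘ ((+ m ℚ./ n) ℚ.* ι n)              ≈⟨ ℚₚ.toℚᵘ-homo-* (+ m ℚ./ n) (ι n) ⟩
  ℚ.toℚᵘ (+ m ℚ./ n) ℚᵘ.* ℚ.toℚᵘ (ι n)      ≈⟨ ℚᵘₚ.*-cong (ℚₚ.toℚᵘ-fromℚᵘ (ℚᵘ.mkℚᵘ (+ m) n-1)) (toℚᵘ-ι n) ⟩
  ℚᵘ.mkℚᵘ (+ m) n-1 ℚᵘ.* ℚᵘ.mkℚᵘ (+ n) 0    ≈⟨ ℚᵘ.*≡* (trans (ℤₚ.*-identityʳ _) (cong (+ m ℤ.*_) (cong +_ (sym (ℕₚ.*-identityʳ n))))) ⟩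
  ℚᵘ.mkℚᵘ (+ m) 0                           ≈⟨ toℚᵘ-ι m ⟨
  ℚ.toℚᵘ (ι m) ∎)
  where open ℚᵘₚ.≃-Reasoning

-- Every linear inequality below is a nonnegative combination of known ones;
-- the solver only has to check that the slacks agree.
slack : ∀ {p q a b} → a ℚ.≤ b → q ℚ.- p ≡ b ℚ.- a → p ℚ.≤ q
slack {p} {q} {a} {b} a≤b e = begin
  p                       ≡⟨ S.solve 2 (λ p a → p := (a :- a) :+ p) refl p a ⟩
  (a ℚ.- a) ℚ.+ p         ≤⟨ ℚₚ.+-monoˡ-≤ p (ℚₚ.+-monoˡ-≤ (ℚ.- a) a≤b) ⟩
  (b ℚ.- a) ℚ.+ p         ≡⟨ cong (ℚ._+ p) (sym e) ⟩
  (q ℚ.- p) ℚ.+ p         ≡⟨ S.solve 2 (λ p q → (q :- p) :+ p := q) refl p q ⟩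
  q                       ∎
  where open ℚₚ.≤-Reasoning

p≤p+q : ∀ {p q} → 0ℚ ℚ.≤ q → p ℚ.≤ p ℚ.+ q
p≤p+q {p} {q} 0≤q = slack 0≤q (S.solve 2 (λ p q → p :+ q :- p := q :- con 0ℚ) refl p q)

*-monoʳ : ∀ {c p q} → 0ℚ ℚ.≤ c → p ℚ.≤ q → c ℚ.* p ℚ.≤ c ℚ.* q
*-monoʳ {c} 0≤c = ℚₚ.*-monoˡ-≤-nonNeg c {{ℚ.nonNegative 0≤c}}

*-monoˡ : ∀ {c p q} → 0ℚ ℚ.≤ c → p ℚ.≤ q → p ℚ.* c ℚ.≤ q ℚ.* c
*-monoˡ {c} 0≤c = ℚₚ.*-monoʳ-≤-nonNeg c {{ℚ.nonNegative 0≤c}}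

0≤* : ∀ {p q} → 0ℚ ℚ.≤ p → 0ℚ ℚ.≤ q → 0ℚ ℚ.≤ p ℚ.* q
0≤* {p} {q} 0≤p 0≤q = subst (ℚ._≤ p ℚ.* q) (ℚₚ.*-zeroʳ p) (*-monoʳ 0≤p 0≤q)

0≤+ : ∀ {p q} → 0ℚ ℚ.≤ p → 0ℚ ℚ.≤ q → 0ℚ ℚ.≤ p ℚ.+ q
0≤+ = ℚₚ.+-mono-≤

0<* : ∀ {p q} → 0ℚ ℚ.< p → 0ℚ ℚ.< q → 0ℚ ℚ.< p ℚ.* q
0<* {p} {q} 0<p 0<q = ℚₚ.positive⁻¹ _ {{ℚₚ.pos*pos⇒pos p {{ℚ.positive 0<p}} q {{ℚ.positive 0<q}}}}

∣∣≤ : ∀ {p q} → p ℚ.≤ q → ℚ.- p ℚ.≤ q → ∣ p ∣ ℚ.≤ q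
∣∣≤ {p} p≤q -p≤q with ℚₚ.∣p∣≡p∨∣p∣≡-p p
... | inj₁ e = subst (ℚ._≤ _) (sym e) p≤q
... | inj₂ e = subst (ℚ._≤ _) (sym e) -p≤q

-- The denominator of `η` is a witness, since multiplying by it leaves the numerator, a positive
-- integer.
archimedean : ∀ {η} → 0ℚ ℚ.< η → ∃[ M ] 1ℚ ℚ.≤ η ℚ.* ι M
archimedean {η} 0<η = ℚ.↧ₙ η , (begin
  1ℚ                     ≤⟨ num η {{ℚ.positive 0<η}} ⟩
  ℚ.↥ η ℚ./ 1            ≡⟨ mul η {{ℚ.positive 0<η}} ⟨
  η ℚ.* ι (ℚ.↧ₙ η)       ∎)
  where
  open ℚₚ.≤-Reasoning
  num : ∀ η .{{_ : ℚ.Positive η}} → 1ℚ ℚ.≤ ℚ.↥ η ℚ./ 1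
  num (ℚ.mkℚ ℤ.+[1+ n ] d c) = ι-mono {1} {suc n} (ℕ.s≤s ℕ.z≤n)
  mul : ∀ η .{{_ : ℚ.Positive η}} → η ℚ.* ι (ℚ.↧ₙ η) ≡ ℚ.↥ η ℚ./ 1
  mul η@(ℚ.mkℚ ℤ.+[1+ n ] d c) =
    trans (cong (ℚ._* ι (suc d)) (sym (ℚₚ.↥p/↧p≡p η))) (/-*-cancel (suc n) (suc d))

ι*recip : ∀ n .{{_ : NonZero n}} → ι n ℚ.* recip n ≡ 1ℚ
ι*recip (suc n) = trans (ℚₚ.*-comm (ι (suc n)) _) (/-*-cancel 1 (suc n))

0≤recip : ∀ n → 0ℚ ℚ.≤ recip n
0≤recip zero    = ℚₚ.≤-refl
0≤recip (suc n) = ℚₚ.nonNegative⁻¹ _ {{ℚₚ.normalize-nonNeg 1 (suc n)}}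

0<recip : ∀ n .{{_ : NonZero n}} → 0ℚ ℚ.< recip n
0<recip (suc n) = ℚₚ.positive⁻¹ _ {{ℚₚ.normalize-pos 1 (suc n)}}

recip≤1 : ∀ n → recip n ℚ.≤ 1ℚ
recip≤1 zero        = ℚₚ.<⇒≤ 0<1
recip≤1 n@(suc n-1) = begin
  recip n            ≡⟨ ℚₚ.*-identityˡ (recip n) ⟨
  ι 1 ℚ.* recip n    ≤⟨ *-monoˡ (0≤recip n) (ι-mono {1} {n} (ℕ.s≤s ℕ.z≤n)) ⟩
  ι n ℚ.* recip n    ≡⟨ ι*recip n ⟩
  1ℚ                 ∎
  where open ℚₚ.≤-Reasoning

-- For the Cantor sums: one unit of a place is `q` units of the following place.
ι*recip-* : ∀ m n .{{_ : NonZero m}} .{{_ : NonZero n}} → ι n ℚ.* recip (m ℕ.* n) ≡ recip m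
ι*recip-* m n = begin
  ι n ℚ.* r                       ≡⟨ ℚₚ.*-identityˡ _ ⟨
  1ℚ ℚ.* (ι n ℚ.* r)              ≡⟨ cong (ℚ._* (ι n ℚ.* r)) (ι*recip m) ⟨
  ι m ℚ.* recip m ℚ.* (ι n ℚ.* r) ≡⟨ S.solve 4 (λ a b c d → a :* b :* (c :* d) := b :* (a :* c :* d)) refl (ι m) (recip m) (ι n) r ⟩
  recip m ℚ.* (ι m ℚ.* ι n ℚ.* r) ≡⟨ cong (λ z → recip m ℚ.* (z ℚ.* r)) (ι-* m n) ⟨
  recip m ℚ.* (ι (m ℕ.* n) ℚ.* r) ≡⟨ cong (recip m ℚ.*_) (ι*recip (m ℕ.* n) {{ℕₚ.m*n≢0 m n}}) ⟩
  recip m ℚ.* 1ℚ                  ≡⟨ ℚₚ.*-identityʳ _ ⟩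
  recip m                         ∎
  where
  open ≡-Reasoning
  r = recip (m ℕ.* n)

ratio-near-1 : ∀ {a c δ} → 0ℚ ℚ.< c → ∣ a ℚ.- c ∣ ℚ.≤ δ ℚ.* c →
           Σ[ nz ∈ ℚ.NonZero c ] ∣ (a ÷ c) {{nz}} ℚ.- 1ℚ ∣ ℚ.≤ δ
ratio-near-1 {a} {c} {δ} 0<c h = nz , (begin
  ∣ a ℚ.* d ℚ.- 1ℚ ∣          ≡⟨ cong (λ z → ∣ a ℚ.* d ℚ.- z ∣) (ℚₚ.*-inverseʳ c {{nz}}) ⟨
  ∣ a ℚ.* d ℚ.- c ℚ.* d ∣     ≡⟨ cong ∣_∣ (S.solve 3 (λ a c d → a :* d :- c :* d := (a :- c) :* d) refl a c d) ⟩
  ∣ (a ℚ.- c) ℚ.* d ∣         ≡⟨ ℚₚ.∣p*q∣≡∣p∣*∣q∣ (a ℚ.- c) d ⟩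
  ∣ a ℚ.- c ∣ ℚ.* ∣ d ∣       ≡⟨ cong (∣ a ℚ.- c ∣ ℚ.*_) (ℚₚ.0≤p⇒∣p∣≡p 0≤d) ⟩
  ∣ a ℚ.- c ∣ ℚ.* d           ≤⟨ *-monoˡ 0≤d h ⟩
  δ ℚ.* c ℚ.* d               ≡⟨ ℚₚ.*-assoc δ c d ⟩
  δ ℚ.* (c ℚ.* d)             ≡⟨ cong (δ ℚ.*_) (ℚₚ.*-inverseʳ c {{nz}}) ⟩
  δ ℚ.* 1ℚ                    ≡⟨ ℚₚ.*-identityʳ δ ⟩
  δ                           ∎)
  where
  open ℚₚ.≤-Reasoning
  instance
    c-pos = ℚ.positive 0<c
  nz = ℚₚ.pos⇒nonZero c
  d = (1/ c) {{nz}}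
  0≤d : 0ℚ ℚ.≤ d
  0≤d = ℚₚ.<⇒≤ (ℚₚ.positive⁻¹ d {{ℚₚ.1/pos⇒pos c}})

-- Slowly growing sums along concatenated copies

infixr 2 _⊓ᴱ_
_⊓ᴱ_ : ∀ {P R : Pred ℕ 0ℓ} → Eventually P → Eventually R → Eventually (λ n → P n × R n)
(M , p) ⊓ᴱ (M′ , r) = M ℕ.⊔ M′ , λ n h →
  p n (ℕₚ.m⊔n≤o⇒m≤o M M′ h) , r n (ℕₚ.m⊔n≤o⇒n≤o M M′ h)

mapᴱ : ∀ {P R : Pred ℕ 0ℓ} → (∀ n → P n → R n) → Eventually P → Eventually R
mapᴱ f (M , p) = M , λ n h → f n (p n h)

sucᴱ : ∀ {P : Pred ℕ 0ℓ} → Eventually (λ n → P (suc n)) → Eventually P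
sucᴱ (M , p) = suc M , λ { (suc n) (ℕ.s≤s h) → p n h }

-- Shared by the occurrence count and by the sum `Qsum`. Over `d` positions both move by an amount
-- between 0 and `d`, so an incomplete copy can separate them by at most its length.
record Slow (A : ℕ → ℚ) : Set where
  field
    at0  : A 0 ≡ 0ℚ
    mono : ∀ n → A n ℚ.≤ A (suc n)
    slow : ∀ n → A (suc n) ℚ.≤ A n ℚ.+ 1ℚ

module _ {A : ℕ → ℚ} (A-slow : Slow A) where
  open Slow A-slow

  increasing : ∀ n d → A n ℚ.≤ A (n ℕ.+ d)
  increasing n zero    = ℚₚ.≤-reflexive (cong A (sym (ℕₚ.+-identityʳ n)))
  increasing n (suc d) = begin
    A n               ≤⟨ increasing n d ⟩
    A (n ℕ.+ d)       ≤⟨ mono (n ℕ.+ d) ⟩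
    A (suc (n ℕ.+ d)) ≡⟨ cong A (ℕₚ.+-suc n d) ⟨
    A (n ℕ.+ suc d)   ∎
    where open ℚₚ.≤-Reasoning

  lipschitz : ∀ n d → A (n ℕ.+ d) ℚ.≤ A n ℚ.+ ι d
  lipschitz n zero    = ℚₚ.≤-reflexive (trans (cong A (ℕₚ.+-identityʳ n)) (sym (ℚₚ.+-identityʳ (A n))))
  lipschitz n (suc d) = begin
    A (n ℕ.+ suc d)        ≡⟨ cong A (ℕₚ.+-suc n d) ⟩
    A (suc (n ℕ.+ d))      ≤⟨ slow (n ℕ.+ d) ⟩
    A (n ℕ.+ d) ℚ.+ 1ℚ     ≤⟨ ℚₚ.+-monoˡ-≤ 1ℚ (lipschitz n d) ⟩
    A n ℚ.+ ι d ℚ.+ 1ℚ     ≡⟨ S.solve 3 (λ a d o → a :+ d :+ o := a :+ (o :+ d)) refl (A n) (ι d) 1ℚ ⟩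
    A n ℚ.+ (1ℚ ℚ.+ ι d)   ≡⟨ cong (A n ℚ.+_) (ι-+ 1 d) ⟨
    A n ℚ.+ ι (suc d)      ∎
    where open ℚₚ.≤-Reasoning

  increasing-≤ : ∀ {m n} → m ℕ.≤ n → A m ℚ.≤ A n
  increasing-≤ {m} {n} m≤n = subst (λ z → A m ℚ.≤ A z) (ℕₚ.m+[n∸m]≡n m≤n) (increasing m (n ℕ.∸ m))

  0≤slow : ∀ n → 0ℚ ℚ.≤ A n
  0≤slow n = subst (ℚ._≤ A n) at0 (increasing 0 n)

diff-bound : ∀ {a a′ c c′ d} → a ℚ.≤ a′ → a′ ℚ.≤ a ℚ.+ d → c ℚ.≤ c′ → c′ ℚ.≤ c ℚ.+ d →
             ∣ (a′ ℚ.- a) ℚ.- (c′ ℚ.- c) ∣ ℚ.≤ d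
diff-bound {a} {a′} {c} {c′} {d} a≤ ≤a c≤ ≤c = ∣∣≤
  (slack (ℚₚ.+-mono-≤ ≤a c≤)
    (S.solve 5 (λ a a′ c c′ d → d :- (a′ :- a :- (c′ :- c)) := (a :+ d :+ c′) :- (a′ :+ c)) refl a a′ c c′ d))
  (slack (ℚₚ.+-mono-≤ a≤ ≤c)
    (S.solve 5 (λ a a′ c c′ d → d :- (S.:- (a′ :- a :- (c′ :- c))) := (a′ :+ (c :+ d)) :- (a :+ c′)) refl a a′ c c′ d))

-- From position start i on there are reps i consecutive copies of length len i.
module Comparison
  (len reps start : ℕ → ℕ)
  (start-suc : ∀ i → start (suc i) ≡ start i ℕ.+ reps i ℕ.* len i)
  where

  copyAt : ℕ → ℕ → ℕ
  copyAt i m = start i ℕ.+ m ℕ.* len i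

  copyAt-suc : ∀ i m → copyAt i (suc m) ≡ copyAt i m ℕ.+ len i
  copyAt-suc i m = trans (cong (start i ℕ.+_) (ℕₚ.+-comm (len i) (m ℕ.* len i)))
                         (sym (ℕₚ.+-assoc (start i) (m ℕ.* len i) (len i)))

  Nonempty : ℕ → Set
  Nonempty i = 0 ℕ.< reps i ℕ.* len i

  -- A scan upwards from `start i₀`: the level changes exactly when the position reaches
  -- `start (suc i)`, and nonemptiness keeps that position inside the new level.
  locate : ∀ {i₀} → (∀ i → i₀ ℕ.≤ i → Nonempty i) → ∀ n → start i₀ ℕ.≤ n →
           ∃[ i ] i₀ ℕ.≤ i × start i ℕ.≤ n × n ℕ.< start (suc i)
  locate {i₀} nonempty n i₀≤n with ℕₚ.m≤n⇒∃[o]m+o≡n i₀≤n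
  ... | d , refl = go d
    where
    start-< : ∀ i → i₀ ℕ.≤ i → start i ℕ.< start (suc i)
    start-< i i₀≤i = subst (start i ℕ.<_) (sym (start-suc i))
      (ℕₚ.m<m+n (start i) (nonempty i i₀≤i))
    go : ∀ d → ∃[ i ] i₀ ℕ.≤ i × start i ℕ.≤ start i₀ ℕ.+ d × start i₀ ℕ.+ d ℕ.< start (suc i)
    go zero    = i₀ , ℕₚ.≤-refl , ℕₚ.m≤m+n (start i₀) 0
               , subst (ℕ._< start (suc i₀)) (sym (ℕₚ.+-identityʳ (start i₀))) (start-< i₀ ℕₚ.≤-refl)
    go (suc d) rewrite ℕₚ.+-suc (start i₀) d with go d
    ... | i , i₀≤i , s≤ , <s with suc (start i₀ ℕ.+ d) ℕ.<? start (suc i)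
    ... | yes lt = i , i₀≤i , ℕₚ.m≤n⇒m≤1+n s≤ , lt
    ... | no ¬lt with ℕₚ.≤-antisym <s (ℕₚ.≮⇒≥ ¬lt)
    ... | e = suc i , ℕₚ.m≤n⇒m≤1+n i₀≤i , ℕₚ.≤-reflexive (sym e)
            , subst (ℕ._< start (suc (suc i))) (sym e) (start-< (suc i) (ℕₚ.m≤n⇒m≤1+n i₀≤i))

  locateCopy : ∀ i n → Nonempty i → start i ℕ.≤ n → n ℕ.< start (suc i) →
               ∃[ m ] ∃[ r ] m ℕ.< reps i × r ℕ.≤ len i × n ≡ copyAt i m ℕ.+ r
  locateCopy i n ne s≤n n<s with ℕₚ.m≤n⇒∃[o]m+o≡n s≤n
  ... | d , refl = d / len i , d % len i , m<reps , ℕₚ.<⇒≤ (m%n<n d (len i)) , eq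
    where
    instance
      len≢0 : NonZero (len i)
      len≢0 = ℕₚ.m*n≢0⇒n≢0 (reps i) {{ℕ.>-nonZero ne}}
    d≡ : d ≡ d / len i ℕ.* len i ℕ.+ d % len i
    d≡ = trans (m≡m%n+[m/n]*n d (len i)) (ℕₚ.+-comm (d % len i) _)
    eq : start i ℕ.+ d ≡ copyAt i (d / len i) ℕ.+ d % len i
    eq = trans (cong (start i ℕ.+_) d≡) (sym (ℕₚ.+-assoc (start i) _ _))
    d< : d ℕ.< reps i ℕ.* len i
    d< = ℕₚ.+-cancelˡ-< (start i) _ _ (subst (start i ℕ.+ d ℕ.<_) (start-suc i) n<s)
    m<reps : d / len i ℕ.< reps i
    m<reps = ℕₚ.*-cancelʳ-< (len i) _ _
      (ℕₚ.≤-<-trans (subst (d / len i ℕ.* len i ℕ.≤_) (sym d≡) (ℕₚ.m≤m+n _ _)) d<)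

  module _ {A C : ℕ → ℚ} (A-slow : Slow A) (C-slow : Slow C) {θ : ℚ} (0≤θ : 0ℚ ℚ.≤ θ) (i₀ : ℕ)
    (nonempty : ∀ i → i₀ ℕ.≤ i → Nonempty i)
    (copies : ∀ i m → i₀ ℕ.≤ i → m ℕ.< reps i →
              ∣ (A (copyAt i m ℕ.+ len i) ℚ.- A (copyAt i m)) ℚ.- (C (copyAt i m ℕ.+ len i) ℚ.- C (copyAt i m)) ∣
                ℚ.≤ θ ℚ.* (C (copyAt i m ℕ.+ len i) ℚ.- C (copyAt i m)))
    (next : ∀ i → i₀ ℕ.≤ i → ι (len (suc i)) ℚ.≤ θ ℚ.* C (start (suc i)))
    (len⟶∞ : len ⟶∞)
    where

    private
      c : ℚ
      c = ι (start i₀)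

    -- An invariant that survives appending a copy: the error of the copy is `θ` times the increment
    -- of `C`, and these increments telescope. The constant `c` carries whatever happened before the
    -- threshold.
    Close : ℕ → Set
    Close n = ∣ A n ℚ.- C n ∣ ℚ.≤ c ℚ.+ θ ℚ.* C n

    triangle : ∀ s n → ∣ A n ℚ.- C n ∣ ℚ.≤ ∣ A s ℚ.- C s ∣ ℚ.+ ∣ (A n ℚ.- A s) ℚ.- (C n ℚ.- C s) ∣
    triangle s n = begin
      ∣ A n ℚ.- C n ∣ ≡⟨ cong ∣_∣ (S.solve 4 (λ a c a′ c′ → a′ :- c′ := (a :- c) :+ (a′ :- a :- (c′ :- c))) refl (A s) (C s) (A n) (C n)) ⟩
      ∣ (A s ℚ.- C s) ℚ.+ ((A n ℚ.- A s) ℚ.- (C n ℚ.- C s)) ∣ ≤⟨ ℚₚ.∣p+q∣≤∣p∣+∣q∣ (A s ℚ.- C s) _ ⟩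
      ∣ A s ℚ.- C s ∣ ℚ.+ ∣ (A n ℚ.- A s) ℚ.- (C n ℚ.- C s) ∣ ∎
      where open ℚₚ.≤-Reasoning hiding (start)

    close-copyAt : ∀ i → i₀ ℕ.≤ i → Close (start i) → ∀ m → m ℕ.≤ reps i → Close (copyAt i m)
    close-copyAt i i₀≤i h zero    _   = subst Close (sym (ℕₚ.+-identityʳ (start i))) h
    close-copyAt i i₀≤i h (suc m) m<l = subst Close (sym (copyAt-suc i m)) (begin
      ∣ A n ℚ.- C n ∣                                       ≤⟨ triangle s n ⟩
      ∣ A s ℚ.- C s ∣ ℚ.+ ∣ (A n ℚ.- A s) ℚ.- (C n ℚ.- C s) ∣ ≤⟨ ℚₚ.+-mono-≤ (close-copyAt i i₀≤i h m (ℕₚ.<⇒≤ m<l)) (copies i m i₀≤i m<l) ⟩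
      (c ℚ.+ θ ℚ.* C s) ℚ.+ θ ℚ.* (C n ℚ.- C s)             ≡⟨ S.solve 4 (λ c t x y → (c :+ t :* x) :+ t :* (y :- x) := c :+ t :* y) refl c θ (C s) (C n) ⟩
      c ℚ.+ θ ℚ.* C n ∎)
      where
      open ℚₚ.≤-Reasoning hiding (start)
      s = copyAt i m
      n = s ℕ.+ len i

    close-start : ∀ d → Close (start (i₀ ℕ.+ d))
    -- Nothing is known about the digits before the threshold, but both values lie between 0 and the
    -- position, which is `c`.
    close-start zero rewrite ℕₚ.+-identityʳ i₀ = begin
      ∣ A s ℚ.- C s ∣       ≡⟨ cong ∣_∣ (trans (S.solve 2 (λ a c → a :- c := (a :- con 0ℚ) :- (c :- con 0ℚ)) refl (A s) (C s))
                                 (cong₂ (λ x y → (A s ℚ.- x) ℚ.- (C s ℚ.- y)) (sym (Slow.at0 A-slow)) (sym (Slow.at0 C-slow)))) ⟩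
      ∣ (A s ℚ.- A 0) ℚ.- (C s ℚ.- C 0) ∣ ≤⟨ diff-bound (increasing A-slow 0 s) (lipschitz A-slow 0 s) (increasing C-slow 0 s) (lipschitz C-slow 0 s) ⟩
      c                     ≡⟨ ℚₚ.+-identityʳ c ⟨
      c ℚ.+ 0ℚ              ≤⟨ ℚₚ.+-monoʳ-≤ c (0≤* 0≤θ (0≤slow C-slow s)) ⟩
      c ℚ.+ θ ℚ.* C s       ∎
      where
      open ℚₚ.≤-Reasoning hiding (start)
      s = start i₀
    close-start (suc d) rewrite ℕₚ.+-suc i₀ d =
      subst Close (sym (start-suc (i₀ ℕ.+ d)))
        (close-copyAt (i₀ ℕ.+ d) (ℕₚ.m≤m+n i₀ d) (close-start d) (reps (i₀ ℕ.+ d)) ℕₚ.≤-refl)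

    close : Eventually (λ n → 0ℚ ℚ.< C n × ∣ A n ℚ.- C n ∣ ℚ.≤ (θ ℚ.+ θ ℚ.+ θ) ℚ.* C n)
    -- A length above `start i₀` serves twice: `next` then bounds `c` by `θ * C n`, and, the length
    -- being positive, `C n` must be positive too.
    close with len⟶∞ (suc (start i₀))
    ... | M , long = start i₁ , λ n i₁≤n → atPosition n (locate (λ i h → nonempty i (ℕₚ.≤-trans (ℕₚ.m≤n⇒m≤1+n (ℕₚ.m≤m⊔n i₀ M)) h)) n i₁≤n)
      where
      -- `next` bounds a length through the preceding level, which must itself be past `i₀`; hence
      -- the successor.
      i₁ = suc (i₀ ℕ.⊔ M)
      atPosition : ∀ n → ∃[ i ] i₁ ℕ.≤ i × start i ℕ.≤ n × n ℕ.< start (suc i) →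
                   0ℚ ℚ.< C n × ∣ A n ℚ.- C n ∣ ℚ.≤ (θ ℚ.+ θ ℚ.+ θ) ℚ.* C n
      atPosition n (suc i , ℕ.s≤s i₁≤i , s≤n , n<s)
        with locateCopy (suc i) n (nonempty (suc i) (ℕₚ.m≤n⇒m≤1+n (ℕₚ.m⊔n≤o⇒m≤o i₀ M i₁≤i))) s≤n n<s
      ... | m , r , m<l , r≤len , refl = 0<C , (begin
        ∣ A n ℚ.- C n ∣          ≤⟨ triangle s n ⟩
        ∣ A s ℚ.- C s ∣ ℚ.+ ∣ (A n ℚ.- A s) ℚ.- (C n ℚ.- C s) ∣
                                 ≤⟨ ℚₚ.+-mono-≤ closeₛ (diff-bound (increasing A-slow s r) (lipschitz A-slow s r) (increasing C-slow s r) (lipschitz C-slow s r)) ⟩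
        (c ℚ.+ θ ℚ.* C s) ℚ.+ ι r
                                 ≤⟨ ℚₚ.+-mono-≤ (ℚₚ.+-mono-≤ c≤ (*-monoʳ 0≤θ (increasing C-slow s r))) (ℚₚ.≤-trans (ι-mono r≤len) len≤) ⟩
        (θ ℚ.* C n ℚ.+ θ ℚ.* C n) ℚ.+ θ ℚ.* C n
                                 ≡⟨ S.solve 2 (λ t x → t :* x :+ t :* x :+ t :* x := (t :+ t :+ t) :* x) refl θ (C n) ⟩
        (θ ℚ.+ θ ℚ.+ θ) ℚ.* C n  ∎)
        where
        open ℚₚ.≤-Reasoning hiding (start)
        s = copyAt (suc i) m
        i₀≤i : i₀ ℕ.≤ i
        i₀≤i = ℕₚ.m⊔n≤o⇒m≤o i₀ M i₁≤i
        i₀≤1+i : i₀ ℕ.≤ suc i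
        i₀≤1+i = ℕₚ.m≤n⇒m≤1+n i₀≤i
        long′ : suc (start i₀) ℕ.≤ len (suc i)
        long′ = long (suc i) (ℕₚ.m≤n⇒m≤1+n (ℕₚ.m⊔n≤o⇒n≤o i₀ M i₁≤i))
        closeₛ : Close s
        closeₛ = close-copyAt (suc i) i₀≤1+i
          (subst (λ j → Close (start j)) (ℕₚ.m+[n∸m]≡n i₀≤1+i) (close-start (suc i ℕ.∸ i₀)))
          m (ℕₚ.<⇒≤ m<l)
        len≤ : ι (len (suc i)) ℚ.≤ θ ℚ.* C n
        len≤ = ℚₚ.≤-trans (next i i₀≤i) (*-monoʳ 0≤θ (increasing-≤ C-slow s≤n))
        c≤ : c ℚ.≤ θ ℚ.* C n
        c≤ = ℚₚ.≤-trans (ι-mono (ℕₚ.<⇒≤ long′)) len≤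
        0<C : 0ℚ ℚ.< C n
        0<C = ℚₚ.≰⇒> λ C≤0 → ℚₚ.<-irrefl refl (begin-strict
          0ℚ            <⟨ 0<1 ⟩
          ι 1           ≤⟨ ι-mono (ℕₚ.≤-trans (ℕ.s≤s ℕ.z≤n) long′) ⟩
          ι (len (suc i)) ≤⟨ len≤ ⟩
          θ ℚ.* C n     ≤⟨ *-monoʳ 0≤θ C≤0 ⟩
          θ ℚ.* 0ℚ      ≡⟨ ℚₚ.*-zeroʳ θ ⟩
          0ℚ            ∎)

-- Uniqueness of Cantor expansions

∏-nonZero : ∀ n f → (∀ j → NonZero (f j)) → NonZero (∏ n f)
∏-nonZero zero    f h = _
∏-nonZero (suc n) f h = ℕₚ.m*n≢0 (∏ n f) (f n) {{∏-nonZero n f h}} {{h n}}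

q≢0 : ∀ Q n → NonZero (q Q n)
q≢0 Q n = ℕ.>-nonZero (ℕₚ.<-≤-trans (ℕ.s≤s ℕ.z≤n) (2≤q Q n))

-- Here `x` approximates the common limit of two series. Each comparison with it spends `δ` twice,
-- once for convergence and once inside `_≤ᴿ_`.
via-midpoint : ∀ {x e f δ} → x ℚ.≤ e ℚ.+ δ ℚ.+ δ → f ℚ.≤ x ℚ.+ δ ℚ.+ δ → f ℚ.≤ e ℚ.+ (δ ℚ.+ δ ℚ.+ δ ℚ.+ δ)
via-midpoint {x} {e} {f} {δ} x≤e f≤x = slack (ℚₚ.+-mono-≤ x≤e f≤x)
  (S.solve 4 (λ x e f d → e :+ (d :+ d :+ d :+ d) :- f := (e :+ d :+ d) :+ (x :+ d :+ d) :- (x :+ f)) refl x e f δ)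

-- Four tolerances of an eighth of a gap make half of the gap, which leaves a contradiction.
⅛ : ℚ
⅛ = ½ ℚ.* ½ ℚ.* ½

0<⅛ : 0ℚ ℚ.< ⅛
0<⅛ = ℚₚ.positive⁻¹ ⅛

¬gap : ∀ {g e f} → 0ℚ ℚ.< g → e ℚ.+ g ℚ.≤ f → f ℚ.≤ e ℚ.+ (g ℚ.* ⅛ ℚ.+ g ℚ.* ⅛ ℚ.+ g ℚ.* ⅛ ℚ.+ g ℚ.* ⅛) → ⊥
¬gap {g} {e} {f} 0<g e≤f f≤e = ℚₚ.<-irrefl refl (ℚₚ.<-≤-trans (0<* 0<g (ℚₚ.positive⁻¹ ½))
  (slack (ℚₚ.+-mono-≤ e≤f f≤e)
    (S.solve 3 (λ e f g → con 0ℚ :- g :* con ½ :=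
        f :+ (e :+ (g :* con ⅛ :+ g :* con ⅛ :+ g :* con ⅛ :+ g :* con ⅛)) :- (e :+ g :+ f)) refl e f g)))

module CantorSums (Q : BasicSequence) where

  P≢0 : ∀ n → NonZero (∏ n (q Q))
  P≢0 n = ∏-nonZero n (q Q) (q≢0 Q)

  u : ℕ → ℚ
  u m = recip (∏ m (q Q))

  partial : (ℕ → ℕ) → ℕ → ℚ
  partial E n = Σℚ n (λ j → ι (E j) ℚ.* u (suc j))

  approx-partial : ∀ E n m → approx (Σᴿ n (cantorTerm Q E)) m ≡ partial E n
  approx-partial E zero    m = refl
  approx-partial E (suc n) m = cong (ℚ._+ (ι (E n) ℚ.* u (suc n))) (approx-partial E n m)

  partial-mono : ∀ E n d → partial E n ℚ.≤ partial E (n ℕ.+ d)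
  partial-mono E n zero    = ℚₚ.≤-reflexive (cong (partial E) (sym (ℕₚ.+-identityʳ n)))
  partial-mono E n (suc d) rewrite ℕₚ.+-suc n d = ℚₚ.≤-trans (partial-mono E n d)
    (p≤p+q (0≤* (0≤ι (E (n ℕ.+ d))) (0≤recip (∏ (suc (n ℕ.+ d)) (q Q)))))

  partial-cong : ∀ E F n → (∀ {j} → j ℕ.< n → E j ≡ F j) → partial E n ≡ partial F n
  partial-cong E F zero    h = refl
  partial-cong E F (suc n) h = cong₂ ℚ._+_ (partial-cong E F n (λ j<n → h (ℕₚ.m<n⇒m<1+n j<n)))
                                           (cong (λ e → ι e ℚ.* u (suc n)) (h ℕₚ.≤-refl))

  -- The supremum of the sums that agree with E below n.
  ceil : (ℕ → ℕ) → ℕ → ℚ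
  ceil E n = partial E n ℚ.+ u n

  -- The unit `u n` splits into `q Q n` units `u (suc n)`, and the digit `E n` together with the new
  -- tail term uses `suc (E n)` of them. The case `d = 0` makes `ceil` antitone; `d = 1` is the
  -- strict loss at a digit that is not the last one.
  ceil-drop : ∀ E n d → d ℕ.+ suc (E n) ℕ.≤ q Q n → ceil E (suc n) ℚ.+ ι d ℚ.* u (suc n) ℚ.≤ ceil E n
  ceil-drop E n d h = begin
    (partial E n ℚ.+ ι (E n) ℚ.* v) ℚ.+ v ℚ.+ ι d ℚ.* v
      ≡⟨ S.solve 4 (λ s e v d → s :+ e :* v :+ v :+ d :* v := s :+ (d :+ (con 1ℚ :+ e)) :* v) refl (partial E n) (ι (E n)) v (ι d) ⟩
    partial E n ℚ.+ (ι d ℚ.+ (ι 1 ℚ.+ ι (E n))) ℚ.* v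
      ≡⟨ cong (λ z → partial E n ℚ.+ z ℚ.* v) (trans (cong (ι d ℚ.+_) (sym (ι-+ 1 (E n)))) (sym (ι-+ d (suc (E n))))) ⟩
    partial E n ℚ.+ ι (d ℕ.+ suc (E n)) ℚ.* v
      ≤⟨ ℚₚ.+-monoʳ-≤ (partial E n) (*-monoˡ (0≤recip (∏ (suc n) (q Q))) (ι-mono h)) ⟩
    partial E n ℚ.+ ι (q Q n) ℚ.* v
      ≡⟨ cong (partial E n ℚ.+_) (ι*recip-* (∏ n (q Q)) (q Q n) {{P≢0 n}} {{q≢0 Q n}}) ⟩
    partial E n ℚ.+ u n ∎
    where
    open ℚₚ.≤-Reasoning
    v = u (suc n)

  ceil-anti : ∀ E → (∀ n → E n ℕ.< q Q n) → ∀ n d → ceil E (n ℕ.+ d) ℚ.≤ ceil E n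
  ceil-anti E dig n zero    = ℚₚ.≤-reflexive (cong (ceil E) (ℕₚ.+-identityʳ n))
  ceil-anti E dig n (suc d) rewrite ℕₚ.+-suc n d = ℚₚ.≤-trans
    (ℚₚ.≤-trans (p≤p+q (0≤* (0≤ι 0) (0≤recip (∏ (suc (n ℕ.+ d)) (q Q))))) (ceil-drop E (n ℕ.+ d) 0 (dig (n ℕ.+ d))))
    (ceil-anti E dig n d)

  partials-close : ∀ E F ξ → cantorTerm Q E sumsTo ξ → cantorTerm Q F sumsTo ξ →
                   ∀ δ → 0ℚ ℚ.< δ → Eventually (λ n → partial F n ℚ.≤ partial E n ℚ.+ (δ ℚ.+ δ ℚ.+ δ ℚ.+ δ))
  partials-close E F ξ E→ξ F→ξ δ 0<δ = mapᴱ
    (λ { n ((_ , ξ≤E) , (F≤ξ , _)) → at n (ξ≤E δ 0<δ ⊓ᴱ F≤ξ δ 0<δ) })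
    (E→ξ δ 0<δ ⊓ᴱ F→ξ δ 0<δ)
    where
    at : ∀ n → Eventually (λ m → (approx ξ m ℚ.≤ approx (Σᴿ n (cantorTerm Q E)) m ℚ.+ δ ℚ.+ δ)
                               × (approx (Σᴿ n (cantorTerm Q F)) m ℚ.≤ approx ξ m ℚ.+ δ ℚ.+ δ)) →
         partial F n ℚ.≤ partial E n ℚ.+ (δ ℚ.+ δ ℚ.+ δ ℚ.+ δ)
    at n (m , h) = via-midpoint {e = partial E n} {partial F n}
      (subst (λ e → approx ξ m ℚ.≤ e ℚ.+ δ ℚ.+ δ) (approx-partial E n m) (proj₁ (h m ℕₚ.≤-refl)))
      (subst (ℚ._≤ approx ξ m ℚ.+ δ ℚ.+ δ) (approx-partial F n m) (proj₂ (h m ℕₚ.≤-refl)))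

  -- The larger digit lifts the sums of `F` to `ceil E (suc n)` at least. At `m` the ceiling of `E`
  -- loses one unit `u (suc m)` and never recovers it; as `m` is fixed, the gap does not shrink with
  -- `d`.
  permanent-gap : ∀ E F → (∀ n → E n ℕ.< q Q n) → ∀ n → (∀ {j} → j ℕ.< n → E j ≡ F j) → E n ℕ.< F n →
                  ∀ m → n ℕ.< m → E m ≢ q Q m ℕ.∸ 1 →
                  ∀ d → partial E (suc m ℕ.+ d) ℚ.+ u (suc m) ℚ.≤ partial F (suc m ℕ.+ d)
  permanent-gap E F digE n agree En<Fn m n<m Em≢ d = begin
    partial E M ℚ.+ gap             ≤⟨ ℚₚ.+-monoˡ-≤ gap (p≤p+q {partial E M} (0≤recip (∏ M (q Q)))) ⟩
    ceil E M ℚ.+ gap                ≤⟨ ℚₚ.+-monoˡ-≤ gap (ceil-anti E digE (suc m) d) ⟩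
    ceil E (suc m) ℚ.+ gap          ≡⟨ cong (ceil E (suc m) ℚ.+_) (ℚₚ.*-identityˡ gap) ⟨
    ceil E (suc m) ℚ.+ ι 1 ℚ.* gap  ≤⟨ ceil-drop E m 1 2+Em≤q ⟩
    ceil E m                        ≡⟨ cong (ceil E) (ℕₚ.m+[n∸m]≡n n<m) ⟨
    ceil E (suc n ℕ.+ (m ℕ.∸ suc n)) ≤⟨ ceil-anti E digE (suc n) (m ℕ.∸ suc n) ⟩
    ceil E (suc n)                  ≤⟨ start≤ ⟩
    partial F (suc n)               ≤⟨ partial-mono F (suc n) (M ℕ.∸ suc n) ⟩
    partial F (suc n ℕ.+ (M ℕ.∸ suc n)) ≡⟨ cong (partial F) (ℕₚ.m+[n∸m]≡n (ℕₚ.≤-trans (ℕₚ.m≤n⇒m≤1+n n<m) (ℕₚ.m≤m+n (suc m) d))) ⟩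
    partial F M                     ∎
    where
    open ℚₚ.≤-Reasoning
    gap = u (suc m)
    M = suc m ℕ.+ d
    2+Em≤q : 1 ℕ.+ suc (E m) ℕ.≤ q Q m
    2+Em≤q = ℕₚ.≤-trans (ℕ.s≤s (ℕₚ.≤∧≢⇒< (ℕₚ.<⇒≤pred (digE m)) Em≢))
                        (ℕₚ.≤-reflexive (ℕₚ.suc-pred (q Q m) {{q≢0 Q m}}))
    v = u (suc n)
    start≤ : ceil E (suc n) ℚ.≤ partial F (suc n)
    start≤ = begin
      (partial E n ℚ.+ ι (E n) ℚ.* v) ℚ.+ v    ≡⟨ S.solve 3 (λ s e v → s :+ e :* v :+ v := s :+ (con 1ℚ :+ e) :* v) refl (partial E n) (ι (E n)) v ⟩
      partial E n ℚ.+ (ι 1 ℚ.+ ι (E n)) ℚ.* v  ≡⟨ cong₂ (λ s z → s ℚ.+ z ℚ.* v) (partial-cong E F n agree) (sym (ι-+ 1 (E n))) ⟩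
      partial F n ℚ.+ ι (suc (E n)) ℚ.* v      ≤⟨ ℚₚ.+-monoʳ-≤ (partial F n) (*-monoˡ (0≤recip (∏ (suc n) (q Q))) (ι-mono En<Fn)) ⟩
      partial F n ℚ.+ ι (F n) ℚ.* v            ∎

  ¬first-difference : ∀ E F ξ → IsCantorExpansion Q ξ E → IsCantorExpansion Q ξ F →
                      ∀ n → (∀ {j} → j ℕ.< n → E j ≡ F j) → E n ℕ.< F n → ⊥
  ¬first-difference E F ξ isE isF n agree En<Fn = go (IsCantorExpansion.notLast isE (suc n))
    where
    go : ∃[ m ] (n ℕ.< m × E m ≢ q Q m ℕ.∸ 1) → ⊥
    go (m , n<m , Em≢) = impossible
      (partials-close E F ξ (IsCantorExpansion.value isE) (IsCantorExpansion.value isF) (u (suc m) ℚ.* ⅛) (0<* 0<gap 0<⅛))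
      where
      0<gap : 0ℚ ℚ.< u (suc m)
      0<gap = 0<recip (∏ (suc m) (q Q)) {{P≢0 (suc m)}}
      impossible : Eventually (λ n → partial F n ℚ.≤ partial E n ℚ.+ (u (suc m) ℚ.* ⅛ ℚ.+ u (suc m) ℚ.* ⅛ ℚ.+ u (suc m) ℚ.* ⅛ ℚ.+ u (suc m) ℚ.* ⅛)) → ⊥
      impossible (N , F≤E) = ¬gap {e = partial E (suc m ℕ.+ N)} {partial F (suc m ℕ.+ N)} 0<gap
        (permanent-gap E F (IsCantorExpansion.digits isE) n agree En<Fn m n<m Em≢ N)
        (F≤E (suc m ℕ.+ N) (ℕₚ.m≤n+m N (suc m)))

  expansion-unique : ∀ E F ξ → IsCantorExpansion Q ξ E → IsCantorExpansion Q ξ F → ∀ n → E n ≡ F n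
  expansion-unique E F ξ isE isF = <-rec _ λ n agree → step n (λ j<n → agree j<n)
    where
    step : ∀ n → (∀ {j} → j ℕ.< n → E j ≡ F j) → E n ≡ F n
    step n agree with ℕₚ.<-cmp (E n) (F n)
    ... | tri< lt _ _ = contradiction lt (¬first-difference E F ξ isE isF n agree)
    ... | tri≈ _ eq _ = eq
    ... | tri> _ _ gt = contradiction gt (¬first-difference F E ξ isF isE n (λ j<n → sym (agree j<n)))

-- Occurrences of blocks and sums of constant windows

private variable
  X : Set
  P R : Pred ℕ 0ℓ

applyUpTo-cong : ∀ {f g : ℕ → X} → (∀ t → f t ≡ g t) → ∀ n → applyUpTo f n ≡ applyUpTo g n
applyUpTo-cong h zero    = refl
applyUpTo-cong h (suc n) = cong₂ _∷_ (h 0) (applyUpTo-cong (h ∘ suc) n)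

applyUpTo-+ : ∀ (f : ℕ → X) m n → applyUpTo f (m ℕ.+ n) ≡ applyUpTo f m ++ applyUpTo (λ t → f (m ℕ.+ t)) n
applyUpTo-+ f zero    n = refl
applyUpTo-+ f (suc m) n = cong (f 0 ∷_) (applyUpTo-+ (f ∘ suc) m n)

take-applyUpTo : ∀ (f : ℕ → X) {k n} → k ℕ.≤ n → take k (applyUpTo f n) ≡ applyUpTo f k
take-applyUpTo f ℕ.z≤n       = refl
take-applyUpTo f (ℕ.s≤s k≤n) = cong (f 0 ∷_) (take-applyUpTo (f ∘ suc) k≤n)

drop-applyUpTo : ∀ (f : ℕ → X) m n → drop m (applyUpTo f n) ≡ applyUpTo (λ t → f (m ℕ.+ t)) (n ℕ.∸ m)
drop-applyUpTo f zero    n       = refl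
drop-applyUpTo f (suc m) zero    = refl
drop-applyUpTo f (suc m) (suc n) = drop-applyUpTo (f ∘ suc) m n

++-injective : ∀ (as cs : List X) {bs ds} → length as ≡ length cs → as ++ bs ≡ cs ++ ds → as ≡ cs × bs ≡ ds
++-injective []       []       _ e = refl , e
++-injective (a ∷ as) (c ∷ cs) l e with ∷-injective e
... | refl , e′ with ++-injective as cs (ℕₚ.suc-injective l) e′
... | refl , e″ = refl , e″

applyUpTo-split : ∀ (f : ℕ → X) x n {ys} → applyUpTo f (length x ℕ.+ n) ≡ x ++ ys →
                  applyUpTo f (length x) ≡ x × applyUpTo (λ t → f (length x ℕ.+ t)) n ≡ ys
applyUpTo-split f x n e = ++-injective (applyUpTo f (length x)) x (length-applyUpTo f (length x))
  (trans (sym (applyUpTo-+ f (length x) n)) e)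

copy-of-copies : ∀ (x : List X) n m (g : ℕ → X) → m ℕ.< n →
                 applyUpTo g (n ℕ.* length x) ≡ concat (replicate n x) →
                 applyUpTo (λ t → g (m ℕ.* length x ℕ.+ t)) (length x) ≡ x
copy-of-copies x (suc n) zero    g m<n         e = proj₁ (applyUpTo-split g x (n ℕ.* length x) e)
copy-of-copies x (suc n) (suc m) g (ℕ.s≤s m<n) e =
  trans (applyUpTo-cong (λ t → cong g (ℕₚ.+-assoc (length x) (m ℕ.* length x) t)) (length x))
        (copy-of-copies x n m (λ t → g (length x ℕ.+ t)) m<n (proj₂ (applyUpTo-split g x (n ℕ.* length x) e)))

copy-in-word : ∀ W x E → (∀ i → applyUpTo E (L W x i) ≡ word W x i) → ∀ i m → m ℕ.< BFF.l W i →
               applyUpTo (λ t → E (L W x i ℕ.+ m ℕ.* length (x i) ℕ.+ t)) (length (x i)) ≡ x i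
copy-in-word W x E digits i m m<l =
  trans (applyUpTo-cong (λ t → cong E (ℕₚ.+-assoc (L W x i) (m ℕ.* length (x i)) t)) (length (x i)))
        (copy-of-copies (x i) (BFF.l W i) m (λ t → E (L W x i ℕ.+ t)) m<l
          -- The hypothesis at `i` supplies the equality of lengths that allows the prefix to be
          -- cancelled in the hypothesis at `suc i`.
          (proj₂ (++-injective (applyUpTo E (L W x i)) (word W x i) (cong length (digits i))
            (trans (sym (applyUpTo-+ E (L W x i) (BFF.l W i ℕ.* length (x i)))) (digits (suc i))))))

indicator≤1 : ∀ (P? : Decidable P) n → (if does (P? n) then 1 else 0) ℕ.≤ 1
indicator≤1 P? n with does (P? n)
... | true  = ℕₚ.≤-refl
... | false = ℕ.z≤n

indicator-mono : (P? : Decidable P) (R? : Decidable R) → ∀ n m → (P n → R m) →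
                 (if does (P? n) then 1 else 0) ℕ.≤ (if does (R? m) then 1 else 0)
indicator-mono P? R? n m h with P? n | R? m
... | no  _ | _     = ℕ.z≤n
... | yes _ | yes _ = ℕₚ.≤-refl
... | yes p | no ¬r = contradiction (h p) ¬r

count-≤ : ∀ (P? : Decidable P) n → count P? n ℕ.≤ n
count-≤ P? zero    = ℕ.z≤n
count-≤ P? (suc n) = subst (count P? (suc n) ℕ.≤_) (ℕₚ.+-comm n 1) (ℕₚ.+-mono-≤ (count-≤ P? n) (indicator≤1 P? n))

count-mono : (P? : Decidable P) (R? : Decidable R) → ∀ n → (∀ j → j ℕ.< n → P j → R j) → count P? n ℕ.≤ count R? n
count-mono P? R? zero    h = ℕ.z≤n
count-mono P? R? (suc n) h = ℕₚ.+-mono-≤ (count-mono P? R? n (λ j j<n → h j (ℕₚ.m<n⇒m<1+n j<n)))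
                                         (indicator-mono P? R? n n (h n ℕₚ.≤-refl))

count-+ : (P? : Decidable P) → ∀ m n → count P? (m ℕ.+ n) ≡ count P? m ℕ.+ count (λ j → P? (m ℕ.+ j)) n
count-+ P? m zero    = trans (cong (count P?) (ℕₚ.+-identityʳ m)) (sym (ℕₚ.+-identityʳ _))
count-+ P? m (suc n) rewrite ℕₚ.+-suc m n | count-+ P? m n = ℕₚ.+-assoc (count P? m) _ _

count-+-≤ : (P? : Decidable P) → ∀ m n → count P? (m ℕ.+ n) ℕ.≤ count P? m ℕ.+ n
count-+-≤ P? m n rewrite count-+ P? m n = ℕₚ.+-monoʳ-≤ (count P? m) (count-≤ (λ j → P? (m ℕ.+ j)) n)

0<count⇒∃ : (P? : Decidable P) → ∀ n → 0 ℕ.< count P? n → ∃[ j ] j ℕ.< n × P j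
0<count⇒∃ P? (suc n) h with P? n
... | yes p = n , ℕₚ.≤-refl , p
... | no  _ with 0<count⇒∃ P? n (subst (0 ℕ.<_) (ℕₚ.+-identityʳ _) h)
... | j , j<n , p = j , ℕₚ.m<n⇒m<1+n j<n , p

-- Windows that run over the end of y account for the difference of at most k.
module _ {k} (B : Vec ℕ (suc k)) (y : Block) (F : ℕ → ℕ) (s : ℕ)
         (copy : applyUpTo (λ t → F (s ℕ.+ t)) (length y) ≡ y) where

  private
    K = suc k

  window : ∀ j → j ℕ.+ K ℕ.≤ length y → take K (drop j y) ≡ applyUpTo (λ t → F (s ℕ.+ j ℕ.+ t)) K
  window j h = begin
    take K (drop j y) ≡⟨ cong (λ z → take K (drop j z)) copy ⟨
    take K (drop j (applyUpTo (λ t → F (s ℕ.+ t)) (length y)))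
      ≡⟨ cong (take K) (drop-applyUpTo (λ t → F (s ℕ.+ t)) j (length y)) ⟩
    take K (applyUpTo (λ t → F (s ℕ.+ (j ℕ.+ t))) (length y ℕ.∸ j))
      ≡⟨ take-applyUpTo _ (ℕₚ.m+n≤o⇒m≤o∸n K (subst (ℕ._≤ length y) (ℕₚ.+-comm j K) h)) ⟩
    applyUpTo (λ t → F (s ℕ.+ (j ℕ.+ t))) K
      ≡⟨ applyUpTo-cong (λ t → cong F (sym (ℕₚ.+-assoc s j t))) K ⟩
    applyUpTo (λ t → F (s ℕ.+ j ℕ.+ t)) K ∎
    where open ≡-Reasoning

  -- Near the end of `y` the list `take K (drop j y)` is shorter than `K`, hence differs from `B`.
  -- Since `K` is positive, this also excludes the truncated case of the subtraction.
  occurrence-fits : ∀ j → OccursAt B y j → j ℕ.+ K ℕ.≤ length y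
  occurrence-fits j occ = begin
    j ℕ.+ K                  ≤⟨ ℕₚ.+-monoʳ-≤ j K≤ ⟩
    j ℕ.+ (length y ℕ.∸ j)   ≡⟨ ℕₚ.m+[n∸m]≡n {j} (ℕₚ.<⇒≤ (ℕₚ.m∸n≢0⇒n<m {length y} {j} (λ e → ℕₚ.<⇒≱ (ℕ.s≤s ℕ.z≤n) (subst (K ℕ.≤_) e K≤)))) ⟩
    length y                 ∎
    where
    open ℕₚ.≤-Reasoning
    K≤ : K ℕ.≤ length y ℕ.∸ j
    K≤ = ℕₚ.m⊓n≡m⇒m≤n (trans (cong (K ℕ.⊓_) (sym (length-drop j y))) (trans (sym (length-take K (drop j y)))
           (trans (cong length occ) (length-toList B))))

  private
    shifted? : Decidable (λ j → OccursAtω B F (s ℕ.+ j))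
    shifted? j = occursAtω? B F (s ℕ.+ j)

  N≤occurrences : N (length y) B y ℕ.≤ count shifted? (length y)
  N≤occurrences = count-mono (occursAt? B y) shifted? (length y)
    (λ j _ occ → trans (sym (window j (occurrence-fits j occ))) occ)

  occurrences≤N+k : count shifted? (length y) ℕ.≤ N (length y) B y ℕ.+ K
  occurrences≤N+k with ℕₚ.≤-total K (length y)
  ... | inj₂ len≤K = ℕₚ.≤-trans (ℕₚ.≤-trans (count-≤ shifted? (length y)) len≤K) (ℕₚ.m≤n+m K _)
  ... | inj₁ K≤len = begin
    count shifted? (length y)                ≡⟨ cong (count shifted?) (ℕₚ.m∸n+n≡m K≤len) ⟨
    count shifted? (a ℕ.+ K)                 ≤⟨ count-+-≤ shifted? a K ⟩
    count shifted? a ℕ.+ K                   ≤⟨ ℕₚ.+-monoˡ-≤ K (count-mono shifted? (occursAt? B y) a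
                                                 (λ j j<a occ → trans (window j (fits j j<a)) occ)) ⟩
    count (occursAt? B y) a ℕ.+ K            ≤⟨ ℕₚ.+-monoˡ-≤ K (ℕₚ.m≤m+n _ _) ⟩
    count (occursAt? B y) a ℕ.+ count (λ j → occursAt? B y (a ℕ.+ j)) K ℕ.+ K
                                             ≡⟨ cong (ℕ._+ K) (count-+ (occursAt? B y) a K) ⟨
    count (occursAt? B y) (a ℕ.+ K) ℕ.+ K    ≡⟨ cong (λ n → count (occursAt? B y) n ℕ.+ K) (ℕₚ.m∸n+n≡m K≤len) ⟩
    N (length y) B y ℕ.+ K                   ∎
    where
    open ℕₚ.≤-Reasoning
    a = length y ℕ.∸ K
    fits : ∀ j → j ℕ.< a → j ℕ.+ K ℕ.≤ length y
    fits j j<a = ℕₚ.≤-trans (ℕₚ.+-monoˡ-≤ K (ℕₚ.<⇒≤ j<a)) (ℕₚ.≤-reflexive (ℕₚ.m∸n+n≡m K≤len))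

-- Counts and window sums as slow sequences

count-slow : (P? : Decidable P) → Slow (λ n → ι (count P? n))
count-slow P? = record
  { at0  = refl
  ; mono = λ n → ι-mono (ℕₚ.m≤m+n (count P? n) _)
  ; slow = λ n → subst (ι (count P? (suc n)) ℚ.≤_) (ι-+ (count P? n) 1) (ι-mono (ℕₚ.+-monoʳ-≤ (count P? n) (indicator≤1 P? n)))
  }

Σℚ-slow : ∀ {f} → (∀ j → 0ℚ ℚ.≤ f j) → (∀ j → f j ℚ.≤ 1ℚ) → Slow (λ n → Σℚ n f)
Σℚ-slow 0≤f f≤1 = record
  { at0  = refl
  ; mono = λ n → p≤p+q (0≤f n)
  ; slow = λ n → ℚₚ.+-monoʳ-≤ (Σℚ n _) (f≤1 n)
  }

Σℚ-+ : ∀ f m n → Σℚ (m ℕ.+ n) f ≡ Σℚ m f ℚ.+ Σℚ n (λ j → f (m ℕ.+ j))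
Σℚ-+ f m zero    = trans (cong (λ z → Σℚ z f) (ℕₚ.+-identityʳ m)) (sym (ℚₚ.+-identityʳ _))
Σℚ-+ f m (suc n) = trans (cong (λ z → Σℚ z f) (ℕₚ.+-suc m n))
  (trans (cong (ℚ._+ f (m ℕ.+ n)) (Σℚ-+ f m n)) (ℚₚ.+-assoc (Σℚ m f) _ _))

Σℚ-const : ∀ f r n → (∀ j → j ℕ.< n → f j ≡ r) → Σℚ n f ≡ ι n ℚ.* r
Σℚ-const f r zero    h = sym (ℚₚ.*-zeroˡ r)
Σℚ-const f r (suc n) h = begin
  Σℚ n f ℚ.+ f n          ≡⟨ cong₂ ℚ._+_ (Σℚ-const f r n (λ j j<n → h j (ℕₚ.m<n⇒m<1+n j<n))) (h n ℕₚ.≤-refl) ⟩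
  ι n ℚ.* r ℚ.+ r         ≡⟨ S.solve 2 (λ n r → n :* r :+ r := (con 1ℚ :+ n) :* r) refl (ι n) r ⟩
  (ι 1 ℚ.+ ι n) ℚ.* r     ≡⟨ cong (ℚ._* r) (ι-+ 1 n) ⟨
  ι (suc n) ℚ.* r         ∎
  where open ≡-Reasoning

-- Only the last `K` terms can differ from `r`; their sum and the value `K` times `r` replacing it
-- both lie between 0 and `K`.
Σℚ-almost-const : ∀ f r {K} n → K ℕ.≤ n → (∀ j → 0ℚ ℚ.≤ f j) → (∀ j → f j ℚ.≤ 1ℚ) → 0ℚ ℚ.≤ r → r ℚ.≤ 1ℚ →
                  (∀ j → j ℕ.+ K ℕ.≤ n → f j ≡ r) →
                  ι n ℚ.* r ℚ.≤ Σℚ n f ℚ.+ ι K × Σℚ n f ℚ.≤ ι n ℚ.* r ℚ.+ ι K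
Σℚ-almost-const f r {K} n K≤n 0≤f f≤1 0≤r r≤1 h = lower , upper
  where
  open ℚₚ.≤-Reasoning
  a = n ℕ.∸ K
  a+K≡n : a ℕ.+ K ≡ n
  a+K≡n = ℕₚ.m∸n+n≡m K≤n
  main : Σℚ a f ≡ ι a ℚ.* r
  main = Σℚ-const f r a (λ j j<a → h j (ℕₚ.≤-trans (ℕₚ.+-monoˡ-≤ K (ℕₚ.<⇒≤ j<a)) (ℕₚ.≤-reflexive a+K≡n)))
  slow = Σℚ-slow 0≤f f≤1
  lower : ι n ℚ.* r ℚ.≤ Σℚ n f ℚ.+ ι K
  lower = begin
    ι n ℚ.* r                   ≡⟨ cong (λ z → ι z ℚ.* r) a+K≡n ⟨
    ι (a ℕ.+ K) ℚ.* r           ≡⟨ cong (ℚ._* r) (ι-+ a K) ⟩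
    (ι a ℚ.+ ι K) ℚ.* r         ≡⟨ ℚₚ.*-distribʳ-+ r (ι a) (ι K) ⟩
    ι a ℚ.* r ℚ.+ ι K ℚ.* r     ≤⟨ ℚₚ.+-mono-≤ (ℚₚ.≤-reflexive (sym main)) (*-monoʳ (0≤ι K) r≤1) ⟩
    Σℚ a f ℚ.+ ι K ℚ.* 1ℚ       ≤⟨ ℚₚ.+-mono-≤ (increasing slow a K) (ℚₚ.≤-reflexive (ℚₚ.*-identityʳ (ι K))) ⟩
    Σℚ (a ℕ.+ K) f ℚ.+ ι K      ≡⟨ cong (λ z → Σℚ z f ℚ.+ ι K) a+K≡n ⟩
    Σℚ n f ℚ.+ ι K              ∎
  upper : Σℚ n f ℚ.≤ ι n ℚ.* r ℚ.+ ι K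
  upper = begin
    Σℚ n f                      ≡⟨ cong (λ z → Σℚ z f) a+K≡n ⟨
    Σℚ (a ℕ.+ K) f              ≤⟨ lipschitz slow a K ⟩
    Σℚ a f ℚ.+ ι K              ≡⟨ cong (ℚ._+ ι K) main ⟩
    ι a ℚ.* r ℚ.+ ι K           ≤⟨ ℚₚ.+-monoˡ-≤ (ι K) (*-monoˡ 0≤r (ι-mono (ℕₚ.m∸n≤m n K))) ⟩
    ι n ℚ.* r ℚ.+ ι K           ∎

∏-const : ∀ k f b → (∀ t → t ℕ.< k → f t ≡ b) → ∏ k f ≡ b ℕ.^ k
∏-const zero    f b h = refl
∏-const (suc k) f b h = trans (cong₂ ℕ._*_ (∏-const k f b (λ t t<k → h t (ℕₚ.m<n⇒m<1+n t<k))) (h k ℕₚ.≤-refl))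
                              (ℕₚ.*-comm (b ℕ.^ k) b)

-- Rational consequences of inequalities between reals

4ℚ : ℚ
4ℚ = ι 4

0≤1-e : ∀ {e} → e ℚ.≤ 1ℚ → 0ℚ ℚ.≤ 1ℚ ℚ.- e
0≤1-e {e} e≤1 = slack e≤1 (S.solve 1 (λ e → con 1ℚ :- e :- con 0ℚ := con 1ℚ :- e) refl e)

-- Weight and normality each cost a factor `1 - e`, and the slack `r * e` is at most `e * (ℓ * r)`
-- because `1 ≤ ℓ`: a loss of at most `3e`, within the `4e` of the upper bound.
frequency-lower : ∀ {e r ℓ c μ ε} → 0ℚ ℚ.≤ e → e ℚ.≤ 1ℚ → 0ℚ ℚ.≤ r → 1ℚ ℚ.≤ ℓ →
                  r ℚ.≤ μ ℚ.+ r ℚ.* e → ε ℚ.≤ e → μ ℚ.* ℓ ℚ.* (1ℚ ℚ.- ε) ℚ.≤ c ℚ.+ r ℚ.* e →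
                  ℓ ℚ.* r ℚ.≤ c ℚ.+ 4ℚ ℚ.* e ℚ.* (ℓ ℚ.* r)
frequency-lower {e} {r} {ℓ} {c} {μ} {ε} 0≤e e≤1 0≤r 1≤ℓ r≤μ ε≤e h = slack
  (ℚₚ.+-mono-≤ (ℚₚ.+-mono-≤ step h) (ℚₚ.+-mono-≤ (*-monoʳ (0≤* 0≤r 0≤e) 1≤ℓ) (0≤+ (0≤* 0≤e 0≤w) (0≤* (0≤* 0≤e 0≤e) 0≤w))))
  (S.solve 5 (λ e r ℓ c x → c :+ con 4ℚ :* e :* (ℓ :* r) :- ℓ :* r :=
      x :+ (c :+ r :* e) :+ (r :* e :* ℓ :+ (e :* (ℓ :* r) :+ e :* e :* (ℓ :* r)))
      :- ((r :- r :* e) :* ℓ :* (con 1ℚ :- e) :+ x :+ (r :* e :* con 1ℚ :+ con 0ℚ)))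
    refl e r ℓ c (μ ℚ.* ℓ ℚ.* (1ℚ ℚ.- ε)))
  where
  open ℚₚ.≤-Reasoning
  0≤ℓ : 0ℚ ℚ.≤ ℓ
  0≤ℓ = ℚₚ.≤-trans (ℚₚ.<⇒≤ 0<1) 1≤ℓ
  0≤w : 0ℚ ℚ.≤ ℓ ℚ.* r
  0≤w = 0≤* 0≤ℓ 0≤r
  r-re≤μ : r ℚ.- r ℚ.* e ℚ.≤ μ
  r-re≤μ = slack r≤μ (S.solve 3 (λ r e μ → μ :- (r :- r :* e) := μ :+ r :* e :- r) refl r e μ)
  0≤r-re : 0ℚ ℚ.≤ r ℚ.- r ℚ.* e
  0≤r-re = slack (0≤* 0≤r (0≤1-e e≤1)) (S.solve 2 (λ r e → r :- r :* e :- con 0ℚ := r :* (con 1ℚ :- e) :- con 0ℚ) refl r e)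
  step : (r ℚ.- r ℚ.* e) ℚ.* ℓ ℚ.* (1ℚ ℚ.- e) ℚ.≤ μ ℚ.* ℓ ℚ.* (1ℚ ℚ.- ε)
  step = begin
    (r ℚ.- r ℚ.* e) ℚ.* ℓ ℚ.* (1ℚ ℚ.- e)   ≤⟨ *-monoˡ (0≤1-e e≤1) (*-monoˡ 0≤ℓ r-re≤μ) ⟩
    μ ℚ.* ℓ ℚ.* (1ℚ ℚ.- e)                 ≤⟨ *-monoʳ (0≤* (ℚₚ.≤-trans 0≤r-re r-re≤μ) 0≤ℓ) (ℚₚ.+-monoʳ-≤ 1ℚ (ℚₚ.neg-antimono-≤ ε≤e)) ⟩
    μ ℚ.* ℓ ℚ.* (1ℚ ℚ.- ε)                 ∎

-- This side fixes the constant 4: the square of `1 + e` and the slack give `1 + 3e + e * e`, and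
-- `e * e ≤ e`.
frequency-upper : ∀ {e r ℓ c μ ε} → 0ℚ ℚ.≤ e → e ℚ.≤ 1ℚ → 0ℚ ℚ.≤ r → 1ℚ ℚ.≤ ℓ →
                  r ℚ.≤ μ ℚ.+ r ℚ.* e → μ ℚ.≤ r ℚ.+ r ℚ.* e → ε ℚ.≤ e → c ℚ.≤ μ ℚ.* ℓ ℚ.* (1ℚ ℚ.+ ε) ℚ.+ r ℚ.* e →
                  c ℚ.≤ ℓ ℚ.* r ℚ.+ 4ℚ ℚ.* e ℚ.* (ℓ ℚ.* r)
frequency-upper {e} {r} {ℓ} {c} {μ} {ε} 0≤e e≤1 0≤r 1≤ℓ r≤μ μ≤r ε≤e h = slack
  (ℚₚ.+-mono-≤ (ℚₚ.+-mono-≤ step h) (ℚₚ.+-mono-≤ (*-monoʳ (0≤* 0≤r 0≤e) 1≤ℓ) (0≤* (0≤* 0≤e 0≤w) (0≤1-e e≤1))))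
  (S.solve 5 (λ e r ℓ c x → ℓ :* r :+ con 4ℚ :* e :* (ℓ :* r) :- c :=
      (r :+ r :* e) :* ℓ :* (con 1ℚ :+ e) :+ (x :+ r :* e) :+ (r :* e :* ℓ :+ e :* (ℓ :* r) :* (con 1ℚ :- e))
      :- (x :+ c :+ (r :* e :* con 1ℚ :+ con 0ℚ)))
    refl e r ℓ c (μ ℚ.* ℓ ℚ.* (1ℚ ℚ.+ ε)))
  where
  open ℚₚ.≤-Reasoning
  0≤ℓ : 0ℚ ℚ.≤ ℓ
  0≤ℓ = ℚₚ.≤-trans (ℚₚ.<⇒≤ 0<1) 1≤ℓ
  0≤w : 0ℚ ℚ.≤ ℓ ℚ.* r
  0≤w = 0≤* 0≤ℓ 0≤r
  -- `μ` is an approximant of a weight, which could be negative even though the weight is not; its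
  -- distance to `r` rules this out.
  0≤μ : 0ℚ ℚ.≤ μ
  0≤μ = slack (ℚₚ.+-mono-≤ r≤μ (0≤* 0≤r (0≤1-e e≤1)))
    (S.solve 3 (λ r e μ → μ :- con 0ℚ := μ :+ r :* e :+ r :* (con 1ℚ :- e) :- (r :+ con 0ℚ)) refl r e μ)
  step : μ ℚ.* ℓ ℚ.* (1ℚ ℚ.+ ε) ℚ.≤ (r ℚ.+ r ℚ.* e) ℚ.* ℓ ℚ.* (1ℚ ℚ.+ e)
  step = begin
    μ ℚ.* ℓ ℚ.* (1ℚ ℚ.+ ε)                 ≤⟨ *-monoʳ (0≤* 0≤μ 0≤ℓ) (ℚₚ.+-monoʳ-≤ 1ℚ ε≤e) ⟩
    μ ℚ.* ℓ ℚ.* (1ℚ ℚ.+ e)                 ≤⟨ *-monoˡ (0≤+ (ℚₚ.<⇒≤ 0<1) 0≤e) (*-monoˡ 0≤ℓ μ≤r) ⟩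
    (r ℚ.+ r ℚ.* e) ℚ.* ℓ ℚ.* (1ℚ ℚ.+ e)   ∎

-- Stated on approximants, so that it can be intersected with other conditions at one index. The
-- lower side serves to bound differences of two tolerances.
Within : ℚ → ℝ → Set
Within e ε = Eventually (λ n → approx ε n ℚ.≤ e × 0ℚ ℚ.≤ approx ε n ℚ.+ e)

-- The slack in _≤ᴿ_ is absorbed by the factor 4, so that no limit has to be taken.
block-frequency : ∀ {e r μ ε ℓ c} → 0ℚ ℚ.< e → e ℚ.≤ 1ℚ → 0ℚ ℚ.< r → 1 ℕ.≤ ℓ →
                  Within e ε → μ ≃ᴿ fromℚ r →
                  μ *ᴿ fromℕ ℓ *ᴿ (1ᴿ -ᴿ ε) ≤ᴿ fromℕ c × fromℕ c ≤ᴿ μ *ᴿ fromℕ ℓ *ᴿ (1ᴿ +ᴿ ε) →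
                  ι ℓ ℚ.* r ℚ.≤ ι c ℚ.+ 4ℚ ℚ.* e ℚ.* (ι ℓ ℚ.* r) × ι c ℚ.≤ ι ℓ ℚ.* r ℚ.+ 4ℚ ℚ.* e ℚ.* (ι ℓ ℚ.* r)
block-frequency {e} {r} {μ} {ε} {ℓ} {c} 0<e e≤1 0<r 1≤ℓ small (μ≤r , r≤μ) (low , upp) =
  at (μ≤r (r ℚ.* e) 0<re ⊓ᴱ r≤μ (r ℚ.* e) 0<re ⊓ᴱ small ⊓ᴱ low (r ℚ.* e) 0<re ⊓ᴱ upp (r ℚ.* e) 0<re)
  where
  0<re = 0<* 0<r 0<e
  at : Eventually (λ n → approx μ n ℚ.≤ r ℚ.+ r ℚ.* e × r ℚ.≤ approx μ n ℚ.+ r ℚ.* e ×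
         (approx ε n ℚ.≤ e × 0ℚ ℚ.≤ approx ε n ℚ.+ e) ×
         approx μ n ℚ.* ι ℓ ℚ.* (1ℚ ℚ.- approx ε n) ℚ.≤ ι c ℚ.+ r ℚ.* e ×
         ι c ℚ.≤ approx μ n ℚ.* ι ℓ ℚ.* (1ℚ ℚ.+ approx ε n) ℚ.+ r ℚ.* e) →
       ι ℓ ℚ.* r ℚ.≤ ι c ℚ.+ 4ℚ ℚ.* e ℚ.* (ι ℓ ℚ.* r) × ι c ℚ.≤ ι ℓ ℚ.* r ℚ.+ 4ℚ ℚ.* e ℚ.* (ι ℓ ℚ.* r)
  at (n , h) = let (μ≤ , ≤μ , (ε≤e , _) , lo , up) = h n ℕₚ.≤-refl in
    frequency-lower {ℓ = ι ℓ} {ι c} {approx μ n} {approx ε n} (ℚₚ.<⇒≤ 0<e) e≤1 (ℚₚ.<⇒≤ 0<r) (ι-mono 1≤ℓ) ≤μ ε≤e lo ,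
    frequency-upper {ℓ = ι ℓ} {ι c} {approx μ n} {approx ε n} (ℚₚ.<⇒≤ 0<e) e≤1 (ℚₚ.<⇒≤ 0<r) (ι-mono 1≤ℓ) ≤μ μ≤ ε≤e up

⟶0⇒Within : ∀ {s} → s ⟶ 0ᴿ → ∀ {e} → 0ℚ ℚ.< e → Eventually (λ i → Within e (s i))
⟶0⇒Within {s} s→0 {e} 0<e = mapᴱ
  (λ { i (up , lo) → mapᴱ
    (λ { n (u , l) → slack u (S.solve 2 (λ a e → e :- a := con 0ℚ :+ e :* con ½ :+ e :* con ½ :- a) refl (approx (s i) n) e)
                   , slack l (S.solve 2 (λ a e → a :+ e :- con 0ℚ := a :+ e :* con ½ :+ e :* con ½ :- con 0ℚ) refl (approx (s i) n) e) })
    (up (e ℚ.* ½) 0<e/2 ⊓ᴱ lo (e ℚ.* ½) 0<e/2) })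
  (s→0 (e ℚ.* ½) 0<e/2)
  where
  0<e/2 : 0ℚ ℚ.< e ℚ.* ½
  0<e/2 = 0<* 0<e (ℚₚ.positive⁻¹ ½)

-- Two tolerances within `½` of 0 differ by at most 1. The extra 1 is the slack spent on `_≤ᴿ_`.
growth-bound : ∀ {m ℓ ε ε′} → Within ½ ε → Within ½ ε′ → fromℕ m ≤ᴿ fromℕ ℓ *ᴿ (ε -ᴿ ε′) → m ℕ.≤ ℓ ℕ.+ 1
growth-bound {m} {ℓ} {ε} {ε′} small small′ h = at (small ⊓ᴱ small′ ⊓ᴱ h 1ℚ 0<1)
  where
  at : Eventually (λ n → (approx ε n ℚ.≤ ½ × 0ℚ ℚ.≤ approx ε n ℚ.+ ½) × (approx ε′ n ℚ.≤ ½ × 0ℚ ℚ.≤ approx ε′ n ℚ.+ ½) ×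
         ι m ℚ.≤ ι ℓ ℚ.* (approx ε n ℚ.- approx ε′ n) ℚ.+ 1ℚ) → m ℕ.≤ ℓ ℕ.+ 1
  at (n , f) = let ((ε≤ , _) , (_ , ≤ε′) , g) = f n ℕₚ.≤-refl in ι-cancel (begin
    ι m                                               ≤⟨ g ⟩
    ι ℓ ℚ.* (approx ε n ℚ.- approx ε′ n) ℚ.+ 1ℚ       ≤⟨ ℚₚ.+-monoˡ-≤ 1ℚ (*-monoʳ (0≤ι ℓ)
                                                          (slack (ℚₚ.+-mono-≤ ε≤ ≤ε′) (S.solve 2 (λ a b → con 1ℚ :- (a :- b) := con ½ :+ (b :+ con ½) :- (a :+ con 0ℚ)) refl (approx ε n) (approx ε′ n)))) ⟩
    ι ℓ ℚ.* 1ℚ ℚ.+ 1ℚ                                 ≡⟨ cong (ℚ._+ 1ℚ) (ℚₚ.*-identityʳ (ι ℓ)) ⟩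
    ι ℓ ℚ.+ ι 1                                       ≡⟨ ι-+ ℓ 1 ⟨
    ι (ℓ ℕ.+ 1)                                       ∎)
    where open ℚₚ.≤-Reasoning

12ℚ : ℚ
12ℚ = ι 12

half-copy : ∀ {e w K c} → 0ℚ ℚ.≤ w → e ℚ.≤ ½ → K ℚ.≤ e ℚ.* w → w ℚ.≤ c ℚ.+ K → w ℚ.* ½ ℚ.≤ c
half-copy {e} {w} {K} {c} 0≤w e≤½ K≤ew w≤c = slack
  (ℚₚ.+-mono-≤ (ℚₚ.+-mono-≤ K≤ew w≤c) (*-monoˡ 0≤w e≤½))
  (S.solve 4 (λ e w K c → c :- w :* con ½ := e :* w :+ (c :+ K) :+ con ½ :* w :- (K :+ w :+ e :* w)) refl e w K c)

-- The path from `a` through `n` and `w` to `c` costs `K`, `4e * w` and `K`, at most `6e * w` in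
-- all; as `w` is at most twice `c`, the constant is 12.
copy-error : ∀ {e w K n a c} → 0ℚ ℚ.≤ e → e ℚ.≤ ½ → 0ℚ ℚ.≤ w → K ℚ.≤ e ℚ.* w →
             w ℚ.≤ n ℚ.+ 4ℚ ℚ.* e ℚ.* w → n ℚ.≤ w ℚ.+ 4ℚ ℚ.* e ℚ.* w →
             n ℚ.≤ a → a ℚ.≤ n ℚ.+ K → w ℚ.≤ c ℚ.+ K → c ℚ.≤ w ℚ.+ K →
             ∣ a ℚ.- c ∣ ℚ.≤ 12ℚ ℚ.* e ℚ.* c
copy-error {e} {w} {K} {n} {a} {c} 0≤e e≤½ 0≤w K≤ew w≤n n≤w n≤a a≤n w≤c c≤w = ∣∣≤
  (slack (ℚₚ.+-mono-≤ (ℚₚ.+-mono-≤ (ℚₚ.+-mono-≤ a≤n n≤w) w≤c) (ℚₚ.+-mono-≤ (ℚₚ.+-mono-≤ K≤ew K≤ew) ew≤))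
    (S.solve 6 (λ e w K n a c → con 12ℚ :* e :* c :- (a :- c) :=
      n :+ K :+ (w :+ con 4ℚ :* e :* w) :+ (c :+ K) :+ (e :* w :+ e :* w :+ con 12ℚ :* e :* c)
      :- (a :+ n :+ w :+ (K :+ K :+ con 12ℚ :* e :* (w :* con ½)))) refl e w K n a c))
  (slack (ℚₚ.+-mono-≤ (ℚₚ.+-mono-≤ (ℚₚ.+-mono-≤ c≤w w≤n) n≤a) (ℚₚ.+-mono-≤ (ℚₚ.+-mono-≤ K≤ew (0≤* 0≤e 0≤w)) ew≤))
    (S.solve 6 (λ e w K n a c → con 12ℚ :* e :* c :- (S.:- (a :- c)) :=
      w :+ K :+ (n :+ con 4ℚ :* e :* w) :+ a :+ (e :* w :+ e :* w :+ con 12ℚ :* e :* c)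
      :- (c :+ w :+ n :+ (K :+ con 0ℚ :+ con 12ℚ :* e :* (w :* con ½)))) refl e w K n a c))
  where
  ew≤ : 12ℚ ℚ.* e ℚ.* (w ℚ.* ½) ℚ.≤ 12ℚ ℚ.* e ℚ.* c
  ew≤ = *-monoʳ (0≤* (0≤ι 12) 0≤e) (half-copy {e} 0≤w e≤½ K≤ew w≤c)

∈R⇒eventually-≤ : ∀ W {j} → j ∈R W → Eventually (λ i → j ℕ.≤ BFF.k W i)
∈R⇒eventually-≤ W {j} (inj₁ (K , ev , j≤K)) = mapᴱ (λ i k≡K → subst (j ℕ.≤_) (sym k≡K) j≤K) ev
∈R⇒eventually-≤ W {j} (inj₂ k→∞)            = k→∞ j

inBase-bound : ∀ {k} (B : Vec ℕ k) → ∃[ M ] (∀ {b} → M ℕ.≤ b → InBase b B)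
inBase-bound []      = 0 , λ _ → []
inBase-bound (d ∷ B) with inBase-bound B
... | M , h = suc d ℕ.⊔ M , λ M≤b → ℕₚ.m⊔n≤o⇒m≤o (suc d) M M≤b ∷ h (ℕₚ.m⊔n≤o⇒n≤o (suc d) M M≤b)

-- W-good sequences

tolerance : ∀ δ → 0ℚ ℚ.< δ → ∃[ e ] 0ℚ ℚ.< e × e ℚ.≤ ½ × 12ℚ ℚ.* e ℚ.+ 12ℚ ℚ.* e ℚ.+ 12ℚ ℚ.* e ℚ.≤ δ
tolerance δ 0<δ = go (ℚₚ.≤-total δ 1ℚ)
  where
  κ : ℚ
  -- 36 is three errors of `12e` each.
  κ = + 1 ℚ./ 36
  0<κ : 0ℚ ℚ.< κ
  0<κ = ℚₚ.positive⁻¹ κ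
  fit : ∀ c → 0ℚ ℚ.< c → c ℚ.≤ δ → c ℚ.≤ 1ℚ → ∃[ e ] 0ℚ ℚ.< e × e ℚ.≤ ½ × 12ℚ ℚ.* e ℚ.+ 12ℚ ℚ.* e ℚ.+ 12ℚ ℚ.* e ℚ.≤ δ
  fit c 0<c c≤δ c≤1 = c ℚ.* κ , 0<* 0<c 0<κ
    , ℚₚ.≤-trans (*-monoˡ (ℚₚ.<⇒≤ 0<κ) c≤1) (ℚₚ.≤ᵇ⇒≤ tt)
    , slack c≤δ (S.solve 2 (λ c δ → δ :- (con 12ℚ :* (c :* con κ) :+ con 12ℚ :* (c :* con κ) :+ con 12ℚ :* (c :* con κ)) := δ :- c) refl c δ)
  go : δ ℚ.≤ 1ℚ ⊎ 1ℚ ℚ.≤ δ → ∃[ e ] 0ℚ ℚ.< e × e ℚ.≤ ½ × 12ℚ ℚ.* e ℚ.+ 12ℚ ℚ.* e ℚ.+ 12ℚ ℚ.* e ℚ.≤ δ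
  go (inj₁ δ≤1) = fit δ 0<δ ℚₚ.≤-refl δ≤1
  go (inj₂ 1≤δ) = fit 1ℚ 0<1 1≤δ ℚₚ.≤-refl

shiftᴱ : ∀ {P : ℕ → Set} → Eventually P → Eventually (λ n → P (suc n))
shiftᴱ (M , p) = M , λ n h → p (suc n) (ℕₚ.m≤n⇒m≤1+n h)

≤½⇒≤1 : ∀ {e} → e ℚ.≤ ½ → e ℚ.≤ 1ℚ
≤½⇒≤1 e≤½ = ℚₚ.≤-trans e≤½ (ℚₚ.≤ᵇ⇒≤ tt)

module GoodSequence (W : BFF) (x : ℕ → Block) (good : Good W x) where
  open BFF W
  open Good good

  len : ℕ → ℕ
  len i = length (x i)

  open Comparison len l (L W x) (λ i → refl)

  b≢0 : ∀ i → NonZero (b i)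
  b≢0 i = ℕ.>-nonZero (ℕₚ.<-≤-trans (ℕ.s≤s ℕ.z≤n) (2≤b i))

  bᵏ≢0 : ∀ i k → NonZero (b i ℕ.^ k)
  bᵏ≢0 i k = ℕₚ.m^n≢0 (b i) k {{b≢0 i}}

  -- The expected number of occurrences in x i of a block of length K.
  expected : ℕ → ℕ → ℚ
  expected K i = ι (len i) ℚ.* recip (b i ℕ.^ K)

  0≤expected : ∀ K i → 0ℚ ℚ.≤ expected K i
  0≤expected K i = 0≤* (0≤ι (len i)) (0≤recip (b i ℕ.^ K))

  -- Eventually the tolerances differ by at most 1, so `growth` bounds the length itself, up to 1.
  -- Asking for `suc M` gains one more power of `b`, which pays for that 1.
  long : ∀ K → K ∈R W → ∀ M → Eventually (λ i → M ℕ.* b i ℕ.^ K ℕ.≤ len i)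
  long K K∈R M = sucᴱ (mapᴱ bound (small ⊓ᴱ shiftᴱ small ⊓ᴱ growth K K∈R (suc M)))
    where
    small : Eventually (λ i → Within ½ (ε i))
    small = ⟶0⇒Within {ε} ε⟶0 (ℚₚ.positive⁻¹ ½)
    bound : ∀ i → Within ½ (ε i) × Within ½ (ε (suc i)) × fromℕ (suc M ℕ.* b (suc i) ℕ.^ K) ≤ᴿ fromℕ (len (suc i)) *ᴿ (ε i -ᴿ ε (suc i)) →
            M ℕ.* b (suc i) ℕ.^ K ℕ.≤ len (suc i)
    bound i (s , s′ , g) = ℕₚ.+-cancelʳ-≤ 1 (M ℕ.* b (suc i) ℕ.^ K) (len (suc i)) (begin
      M ℕ.* b (suc i) ℕ.^ K ℕ.+ 1                     ≤⟨ ℕₚ.+-monoʳ-≤ _ (ℕ.>-nonZero⁻¹ _ {{bᵏ≢0 (suc i) K}}) ⟩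
      M ℕ.* b (suc i) ℕ.^ K ℕ.+ b (suc i) ℕ.^ K       ≡⟨ ℕₚ.+-comm (M ℕ.* b (suc i) ℕ.^ K) _ ⟩
      suc M ℕ.* b (suc i) ℕ.^ K                       ≤⟨ growth-bound {ε = ε i} {ε (suc i)} s s′ g ⟩
      len (suc i) ℕ.+ 1                               ∎)
      where open ℕₚ.≤-Reasoning

  len⟶∞ : ∀ K → K ∈R W → len ⟶∞
  len⟶∞ K K∈R M = mapᴱ (λ i h → ℕₚ.≤-trans (ℕₚ.m≤m*n M (b i ℕ.^ K) {{bᵏ≢0 i K}}) h) (long K K∈R M)

  -- The little-o condition includes that its denominator `l i * len i` is eventually nonzero, so
  -- any tolerance will do.
  nonempty : ∀ K → K ∈R W → Eventually Nonempty
  nonempty K K∈R = mapᴱ (λ { i (nz , _) → ℕ.>-nonZero⁻¹ _ {{nz}} }) (ratio₂ K K∈R 1ℚ 0<1)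

  next-length : ∀ K → K ∈R W → ∀ {e} → 0ℚ ℚ.< e → Eventually (λ i → ι (len (suc i)) ℚ.≤ e ℚ.* (ι (l i) ℚ.* expected K i))
  next-length K K∈R {e} 0<e = mapᴱ bound (ratio₂ K K∈R e 0<e)
    where
    bound : ∀ i → Σ[ nz ∈ NonZero (l i ℕ.* len i) ] ((+ len (suc i)) ℚ./ (l i ℕ.* len i)) {{nz}} ℚ.≤ e ℚ.* recip (b i ℕ.^ K) →
            ι (len (suc i)) ℚ.≤ e ℚ.* (ι (l i) ℚ.* expected K i)
    bound i (nz , h) = begin
      ι (len (suc i))                                  ≡⟨ /-*-cancel (len (suc i)) c {{nz}} ⟨
      ((+ len (suc i)) ℚ./ c) {{nz}} ℚ.* ι c           ≤⟨ *-monoˡ (0≤ι c) h ⟩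
      e ℚ.* r ℚ.* ι c                                  ≡⟨ cong (e ℚ.* r ℚ.*_) (ι-* (l i) (len i)) ⟩
      e ℚ.* r ℚ.* (ι (l i) ℚ.* ι (len i))              ≡⟨ S.solve 4 (λ e r l n → e :* r :* (l :* n) := e :* (l :* (n :* r))) refl e r (ι (l i)) (ι (len i)) ⟩
      e ℚ.* (ι (l i) ℚ.* (ι (len i) ℚ.* r))            ∎
      where
      open ℚₚ.≤-Reasoning hiding (start)
      c = l i ℕ.* len i
      r = recip (b i ℕ.^ K)

  order-negligible : ∀ K → K ∈R W → ∀ {e} → 0ℚ ℚ.< e → Eventually (λ i → ι K ℚ.≤ e ℚ.* expected K i)
  order-negligible K K∈R {e} 0<e = go (archimedean 0<e)
    where
    go : ∃[ M ] 1ℚ ℚ.≤ e ℚ.* ι M → Eventually (λ i → ι K ℚ.≤ e ℚ.* expected K i)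
    go (M , 1≤eM) = mapᴱ bound (long K K∈R (M ℕ.* K))
      where
      bound : ∀ i → M ℕ.* K ℕ.* b i ℕ.^ K ℕ.≤ len i → ι K ℚ.≤ e ℚ.* expected K i
      bound i h = begin
        ι K                                           ≡⟨ ℚₚ.*-identityˡ (ι K) ⟨
        1ℚ ℚ.* ι K                                    ≤⟨ *-monoˡ (0≤ι K) 1≤eM ⟩
        e ℚ.* ι M ℚ.* ι K                             ≡⟨ trans (ℚₚ.*-assoc e (ι M) (ι K)) (cong (e ℚ.*_) (sym (ι-* M K))) ⟩
        e ℚ.* ι (M ℕ.* K)                             ≡⟨ cong (e ℚ.*_) (trans (cong (ι (M ℕ.* K) ℚ.*_) (ι*recip (b i ℕ.^ K) {{bᵏ≢0 i K}})) (ℚₚ.*-identityʳ _)) ⟨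
        e ℚ.* (ι (M ℕ.* K) ℚ.* (ι (b i ℕ.^ K) ℚ.* r)) ≡⟨ cong (e ℚ.*_) (trans (sym (ℚₚ.*-assoc (ι (M ℕ.* K)) _ r)) (cong (ℚ._* r) (sym (ι-* (M ℕ.* K) (b i ℕ.^ K))))) ⟩
        e ℚ.* (ι (M ℕ.* K ℕ.* b i ℕ.^ K) ℚ.* r)       ≤⟨ *-monoʳ (ℚₚ.<⇒≤ 0<e) (*-monoˡ (0≤recip (b i ℕ.^ K)) (ι-mono h)) ⟩
        e ℚ.* (ι (len i) ℚ.* r)                       ∎
        where
        open ℚₚ.≤-Reasoning hiding (start)
        r = recip (b i ℕ.^ K)

  -- Since `p` tends to infinity, the digits of `B` eventually lie in base `p i`, where the weight
  -- is known. The length may be smaller than `K`, so that the single digit `0` is covered as well.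
  block-frequencies : ∀ K → K ∈R W → ∀ {m} → suc m ℕ.≤ K → (B : Vec ℕ (suc m)) → ∀ {e} → 0ℚ ℚ.< e → e ℚ.≤ ½ →
    Eventually (λ i → expected (suc m) i ℚ.≤ ι (N (len i) B (x i)) ℚ.+ 4ℚ ℚ.* e ℚ.* expected (suc m) i ×
                      ι (N (len i) B (x i)) ℚ.≤ expected (suc m) i ℚ.+ 4ℚ ℚ.* e ℚ.* expected (suc m) i)
  block-frequencies K K∈R {m} m<K B {e} 0<e e≤½ = mapᴱ
    (λ { i (within , K≤k , 1≤len , M≤p) →
      block-frequency {μ = weight (μ i) m B} {ε i} {len i} {N (len i) B (x i)} 0<e (≤½⇒≤1 e≤½)
        (0<recip (b i ℕ.^ suc m) {{bᵏ≢0 i (suc m)}}) 1≤len within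
        (Uniform.uniform (μ-unif i) m B (proj₂ (inBase-bound B) M≤p))
        (normal i m (ℕₚ.≤-trans m<K K≤k) B) })
    (⟶0⇒Within {ε} ε⟶0 0<e ⊓ᴱ ∈R⇒eventually-≤ W K∈R ⊓ᴱ len⟶∞ K K∈R 1 ⊓ᴱ p⟶∞ (proj₁ (inBase-bound B)))

  -- The digit sequence is a parameter: the results are applied both to the given digits and to an
  -- arbitrary expansion.
  module Digits (Q : BasicSequence)
    (levels : ∀ i n → L W x i ℕ.≤ n → n ℕ.< L W x (suc i) → q Q n ≡ b i)
    (E : ℕ → ℕ) (digits : ∀ i → applyUpTo E (L W x i) ≡ word W x i) where

    copy : ∀ i m → m ℕ.< l i → applyUpTo (λ t → E (copyAt i m ℕ.+ t)) (len i) ≡ x i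
    copy = copy-in-word W x E digits

    level : ∀ i m t → m ℕ.< l i → t ℕ.< len i → q Q (copyAt i m ℕ.+ t) ≡ b i
    level i m t m<l t<len = levels i _
      (ℕₚ.≤-trans (ℕₚ.m≤m+n (L W x i) (m ℕ.* len i)) (ℕₚ.m≤m+n _ t))
      (begin-strict
        copyAt i m ℕ.+ t       <⟨ ℕₚ.+-monoʳ-< (copyAt i m) t<len ⟩
        copyAt i m ℕ.+ len i   ≡⟨ copyAt-suc i m ⟨
        copyAt i (suc m)       ≤⟨ ℕₚ.+-monoʳ-≤ (L W x i) (ℕₚ.*-monoˡ-≤ (len i) m<l) ⟩
        L W x (suc i)          ∎)
      where open ℕₚ.≤-Reasoning hiding (start)

    module Order (k : ℕ) (K∈R : suc k ∈R W) (B : Vec ℕ (suc k)) where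
      private
        K = suc k

      A C : ℕ → ℚ
      A n = ι (Nω n B E)
      C n = Qsum Q K n

      term : ℕ → ℚ
      term j = recip (∏ K (λ t → q Q (j ℕ.+ t)))

      0≤term : ∀ j → 0ℚ ℚ.≤ term j
      0≤term j = 0≤recip (∏ K (λ t → q Q (j ℕ.+ t)))

      term≤1 : ∀ j → term j ℚ.≤ 1ℚ
      term≤1 j = recip≤1 (∏ K (λ t → q Q (j ℕ.+ t)))

      A-slow : Slow A
      A-slow = count-slow (occursAtω? B E)

      C-slow : Slow C
      C-slow = Σℚ-slow 0≤term term≤1

      countInCopy : ℕ → ℕ → ℕ
      countInCopy i m = count (λ j → occursAtω? B E (copyAt i m ℕ.+ j)) (len i)

      sumInCopy : ℕ → ℕ → ℚ
      sumInCopy i m = Σℚ (len i) (λ j → term (copyAt i m ℕ.+ j))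

      A-copy : ∀ i m → A (copyAt i m ℕ.+ len i) ℚ.- A (copyAt i m) ≡ ι (countInCopy i m)
      A-copy i m = trans
        (cong (ℚ._- A (copyAt i m)) (trans (cong ι (count-+ (occursAtω? B E) (copyAt i m) (len i))) (ι-+ (Nω (copyAt i m) B E) (countInCopy i m))))
        (S.solve 2 (λ a d → a :+ d :- a := d) refl (A (copyAt i m)) (ι (countInCopy i m)))

      C-copy : ∀ i m → C (copyAt i m ℕ.+ len i) ℚ.- C (copyAt i m) ≡ sumInCopy i m
      C-copy i m = trans
        (cong (ℚ._- C (copyAt i m)) (Σℚ-+ term (copyAt i m) (len i)))
        (S.solve 2 (λ a d → a :+ d :- a := d) refl (C (copyAt i m)) (sumInCopy i m))

      sumInCopy-bounds : ∀ i m → m ℕ.< l i → K ℕ.≤ len i →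
                         expected K i ℚ.≤ sumInCopy i m ℚ.+ ι K × sumInCopy i m ℚ.≤ expected K i ℚ.+ ι K
      sumInCopy-bounds i m m<l K≤len = Σℚ-almost-const _ (recip (b i ℕ.^ K)) (len i) K≤len
        (λ j → 0≤term (copyAt i m ℕ.+ j)) (λ j → term≤1 (copyAt i m ℕ.+ j)) (0≤recip (b i ℕ.^ K)) (recip≤1 (b i ℕ.^ K))
        (λ j j+K≤len → cong recip (∏-const K _ (b i) (λ t t<K →
          trans (cong (q Q) (ℕₚ.+-assoc (copyAt i m) j t))
                (level i m (j ℕ.+ t) m<l (ℕₚ.<-≤-trans (ℕₚ.+-monoʳ-< j t<K) j+K≤len)))))

      -- Everything that holds only for large `i`, collected so that a single threshold serves the
      -- comparison.
      record Regular (e : ℚ) (i : ℕ) : Set where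
        field
          nonempty′ : Nonempty i
          next      : ι (len (suc i)) ℚ.≤ e ℚ.* (ι (l i) ℚ.* expected K i)
          K≤len     : K ℕ.≤ len i
          K≤e       : ι K ℚ.≤ e ℚ.* expected K i
          freq≥     : expected K i ℚ.≤ ι (N (len i) B (x i)) ℚ.+ 4ℚ ℚ.* e ℚ.* expected K i
          freq≤     : ι (N (len i) B (x i)) ℚ.≤ expected K i ℚ.+ 4ℚ ℚ.* e ℚ.* expected K i

      regular : ∀ {e} → 0ℚ ℚ.< e → e ℚ.≤ ½ → Eventually (Regular e)
      regular 0<e e≤½ = mapᴱ
        (λ { i (ne , nx , kl , ke , fl , fu) → record
          { nonempty′ = ne ; next = nx ; K≤len = kl ; K≤e = ke ; freq≥ = fl ; freq≤ = fu } })
        (nonempty K K∈R ⊓ᴱ next-length K K∈R 0<e ⊓ᴱ len⟶∞ K K∈R K ⊓ᴱ order-negligible K K∈R 0<e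
         ⊓ᴱ block-frequencies K K∈R ℕₚ.≤-refl B 0<e e≤½)

      module _ {e} (0<e : 0ℚ ℚ.< e) (e≤½ : e ℚ.≤ ½) where
        open Regular

        -- Half of the expected amount per copy is a crude bound, but it turns the second ratio
        -- condition, stated in terms of `l i` and `len i`, into one on `C`.
        C-copies : ∀ i → Regular e i → ∀ m → m ℕ.≤ l i → ι m ℚ.* (expected K i ℚ.* ½) ℚ.≤ C (copyAt i m)
        C-copies i reg zero    _   = ℚₚ.≤-trans (ℚₚ.≤-reflexive (ℚₚ.*-zeroˡ (expected K i ℚ.* ½))) (0≤slow C-slow (copyAt i 0))
        C-copies i reg (suc m) m<l = begin
          ι (suc m) ℚ.* h                ≡⟨ cong (ℚ._* h) (ι-+ 1 m) ⟩
          (ι 1 ℚ.+ ι m) ℚ.* h            ≡⟨ S.solve 2 (λ m h → (con 1ℚ :+ m) :* h := m :* h :+ h) refl (ι m) h ⟩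
          ι m ℚ.* h ℚ.+ h                ≤⟨ ℚₚ.+-mono-≤ (C-copies i reg m (ℕₚ.<⇒≤ m<l))
                                             (half-copy {e} (0≤expected K i) e≤½ (K≤e reg) (proj₁ (sumInCopy-bounds i m m<l (K≤len reg)))) ⟩
          C (copyAt i m) ℚ.+ sumInCopy i m ≡⟨ Σℚ-+ term (copyAt i m) (len i) ⟨
          C (copyAt i m ℕ.+ len i)       ≡⟨ cong C (copyAt-suc i m) ⟨
          C (copyAt i (suc m))           ∎
          where
          open ℚₚ.≤-Reasoning hiding (start)
          h = expected K i ℚ.* ½

        next-≤ : ∀ i → Regular e i → ι (len (suc i)) ℚ.≤ 12ℚ ℚ.* e ℚ.* C (L W x (suc i))
        next-≤ i reg = scaled (ι (l i)) (expected K i) (C (L W x (suc i)))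
          (0≤slow C-slow (L W x (suc i))) (next reg) (C-copies i reg (l i) ℕₚ.≤-refl)
          where
          -- The two inequalities give `2e * c`; the remaining `10e * c` is padding up to the `θ` of
          -- the complete copies.
          scaled : ∀ ℓ w c → 0ℚ ℚ.≤ c → ∀ {n} → n ℚ.≤ e ℚ.* (ℓ ℚ.* w) → ℓ ℚ.* (w ℚ.* ½) ℚ.≤ c → n ℚ.≤ 12ℚ ℚ.* e ℚ.* c
          scaled ℓ w c 0≤c {n} h h′ = slack
            (ℚₚ.+-mono-≤ (ℚₚ.+-mono-≤ h (*-monoʳ (0≤* (0≤ι 2) 0≤e) h′)) (0≤* (0≤* (0≤ι 10) 0≤e) 0≤c))
            (S.solve 5 (λ e ℓ w c n → con 12ℚ :* e :* c :- n :=
              e :* (ℓ :* w) :+ con (ι 2) :* e :* c :+ con (ι 10) :* e :* c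
              :- (n :+ con (ι 2) :* e :* (ℓ :* (w :* con ½)) :+ con 0ℚ)) refl e ℓ w c n)
            where
            0≤e = ℚₚ.<⇒≤ 0<e

        copies-≤ : ∀ i m → Regular e i → m ℕ.< l i →
          ∣ (A (copyAt i m ℕ.+ len i) ℚ.- A (copyAt i m)) ℚ.- (C (copyAt i m ℕ.+ len i) ℚ.- C (copyAt i m)) ∣
            ℚ.≤ 12ℚ ℚ.* e ℚ.* (C (copyAt i m ℕ.+ len i) ℚ.- C (copyAt i m))
        copies-≤ i m reg m<l = subst₂ (λ a c → ∣ a ℚ.- c ∣ ℚ.≤ 12ℚ ℚ.* e ℚ.* c) (sym (A-copy i m)) (sym (C-copy i m))
          (copy-error (ℚₚ.<⇒≤ 0<e) e≤½ (0≤expected K i) (K≤e reg) (freq≥ reg) (freq≤ reg)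
            (ι-mono (N≤occurrences B (x i) E (copyAt i m) (copy i m m<l)))
            (subst (ι (countInCopy i m) ℚ.≤_) (ι-+ (N (len i) B (x i)) K) (ι-mono (occurrences≤N+k B (x i) E (copyAt i m) (copy i m m<l))))
            (proj₁ (sumInCopy-bounds i m m<l (K≤len reg))) (proj₂ (sumInCopy-bounds i m m<l (K≤len reg))))

        ratio : Eventually (Regular e) → Eventually (λ n → 0ℚ ℚ.< C n × ∣ A n ℚ.- C n ∣ ℚ.≤ (12ℚ ℚ.* e ℚ.+ 12ℚ ℚ.* e ℚ.+ 12ℚ ℚ.* e) ℚ.* C n)
        ratio (i₀ , reg) = close A-slow C-slow (0≤* (0≤ι 12) (ℚₚ.<⇒≤ 0<e)) i₀
          (λ i h → nonempty′ (reg i h))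
          (λ i m h → copies-≤ i m (reg i h))
          (λ i h → next-≤ i (reg i h))
          (len⟶∞ K K∈R)

      frequency-ratio : RatioTendsTo1 (λ n → Nω n B E) (Qsum Q K)
      frequency-ratio δ 0<δ = go (tolerance δ 0<δ)
        where
        go : ∃[ e ] 0ℚ ℚ.< e × e ℚ.≤ ½ × 12ℚ ℚ.* e ℚ.+ 12ℚ ℚ.* e ℚ.+ 12ℚ ℚ.* e ℚ.≤ δ →
             Eventually (λ n → Σ[ nz ∈ ℚ.NonZero (C n) ] ∣ (A n ℚ.÷ C n) {{nz}} ℚ.- 1ℚ ∣ ℚ.≤ δ)
        go (e , 0<e , e≤½ , 36e≤δ) = mapᴱ
          (λ { n (0<C , h) → ratio-near-1 {A n} {C n} 0<C (ℚₚ.≤-trans h (*-monoˡ (ℚₚ.<⇒≤ 0<C) 36e≤δ)) })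
          (ratio 0<e e≤½ (regular 0<e e≤½))

    L-unbounded : ∀ i₀ → (∀ i → i₀ ℕ.≤ i → Nonempty i) → ∀ d → d ℕ.≤ L W x (i₀ ℕ.+ d)
    L-unbounded i₀ ne zero    = ℕ.z≤n
    L-unbounded i₀ ne (suc d) = begin
      suc d                                ≡⟨ ℕₚ.+-comm 1 d ⟩
      d ℕ.+ 1                              ≤⟨ ℕₚ.+-mono-≤ (L-unbounded i₀ ne d) (ne (i₀ ℕ.+ d) (ℕₚ.m≤m+n i₀ d)) ⟩
      L W x (suc (i₀ ℕ.+ d))               ≡⟨ cong (L W x) (ℕₚ.+-suc i₀ d) ⟨
      L W x (i₀ ℕ.+ suc d)                 ∎
      where open ℕₚ.≤-Reasoning hiding (start)

    -- The digit 0 occurs in x i for every large i, and it is not the last one.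
    not-last : ∀ k → suc k ∈R W → ∀ n → ∃[ m ] (n ℕ.≤ m × E m ≢ q Q m ℕ.∸ 1)
    not-last k K∈R n = go (nonempty (suc k) K∈R ⊓ᴱ
        -- With tolerance `⅛` the relative error is `½`, so the count of zeros cannot vanish.
        block-frequencies (suc k) K∈R (ℕ.s≤s ℕ.z≤n) (0 ∷ []) 0<⅛ (ℚₚ.≤ᵇ⇒≤ tt))
      where
      zeros : ℕ → ℕ
      zeros i = N (len i) (0 ∷ []) (x i)
      positive : ∀ i → Nonempty i → expected 1 i ℚ.≤ ι (zeros i) ℚ.+ 4ℚ ℚ.* ⅛ ℚ.* expected 1 i → 0 ℕ.< zeros i
      positive i ne h = ℕₚ.n≢0⇒n>0 λ z → ℚₚ.<-irrefl refl (ℚₚ.<-≤-trans 0<w (w≤0 (expected 1 i)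
          (subst (λ c → expected 1 i ℚ.≤ ι c ℚ.+ 4ℚ ℚ.* ⅛ ℚ.* expected 1 i) z h)))
        where
        0<w : 0ℚ ℚ.< expected 1 i
        0<w = 0<* (ℚₚ.<-≤-trans 0<1 (ι-mono {1} {len i} (ℕ.>-nonZero⁻¹ (len i) {{ℕₚ.m*n≢0⇒n≢0 (l i) {{ℕ.>-nonZero ne}}}})))
                  (0<recip (b i ℕ.^ 1) {{bᵏ≢0 i 1}})
        w≤0 : ∀ w → w ℚ.≤ 0ℚ ℚ.+ 4ℚ ℚ.* ⅛ ℚ.* w → w ℚ.≤ 0ℚ
        w≤0 w h = slack (ℚₚ.+-mono-≤ h h) (S.solve 1 (λ w → con 0ℚ :- w :=
          con 0ℚ :+ con 4ℚ :* con ⅛ :* w :+ (con 0ℚ :+ con 4ℚ :* con ⅛ :* w) :- (w :+ w)) refl w)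
      go : Eventually (λ i → Nonempty i × (expected 1 i ℚ.≤ ι (zeros i) ℚ.+ 4ℚ ℚ.* ⅛ ℚ.* expected 1 i ×
                                           ι (zeros i) ℚ.≤ expected 1 i ℚ.+ 4ℚ ℚ.* ⅛ ℚ.* expected 1 i)) →
           ∃[ m ] (n ℕ.≤ m × E m ≢ q Q m ℕ.∸ 1)
      go (i₀ , h) = found (0<count⇒∃ (occursAt? (0 ∷ []) (x i)) (len i) (positive i ne (proj₁ (proj₂ (h i i₀≤i)))))
        where
        -- The `n` levels from `i₀` on have positive length, so level `i` starts at `n` or later.
        i = i₀ ℕ.+ n
        i₀≤i = ℕₚ.m≤m+n i₀ n
        ne : Nonempty i
        ne = proj₁ (h i i₀≤i)
        0<l : 0 ℕ.< l i
        0<l = ℕ.>-nonZero⁻¹ (l i) {{ℕₚ.m*n≢0⇒m≢0 (l i) {{ℕ.>-nonZero ne}}}}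
        found : ∃[ j ] (j ℕ.< len i × OccursAt (0 ∷ []) (x i) j) → ∃[ m ] (n ℕ.≤ m × E m ≢ q Q m ℕ.∸ 1)
        found (j , _ , occ) = pos
          , ℕₚ.≤-trans (L-unbounded i₀ (λ i′ h′ → proj₁ (h i′ h′)) n)
              (ℕₚ.≤-trans (ℕₚ.m≤m+n (L W x i) 0) (ℕₚ.≤-trans (ℕₚ.m≤m+n _ j) (ℕₚ.m≤m+n _ 0)))
          , λ last → ℕₚ.<⇒≢ (ℕₚ.m<n⇒0<n∸m (2≤q Q pos)) (trans (sym E≡0) last)
          where
          -- The final `0` is the offset inside the one-digit window given by `window`.
          pos = copyAt i 0 ℕ.+ j ℕ.+ 0
          E≡0 : E pos ≡ 0
          E≡0 = proj₁ (∷-injective (trans (sym (window (0 ∷ []) (x i) E (copyAt i 0) (copy i 0 0<l) j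
                  (occurrence-fits (0 ∷ []) (x i) E (copyAt i 0) (copy i 0 0<l) j occ))) occ))

-- Order zero and the conclusion

empty-frequency : ∀ Q (F : ℕ → ℕ) → RatioTendsTo1 (λ n → Nω n [] F) (Qsum Q 0)
-- Count and sum both equal `n`, the empty product being 1; from `n = 1` on the quotient is defined.
empty-frequency Q F δ 0<δ = 1 , λ n 1≤n →
  ratio-near-1 {ι (Nω n [] F)} {Qsum Q 0 n} (subst (0ℚ ℚ.<_) (sym (sum≡ n)) (ℚₚ.<-≤-trans 0<1 (ι-mono 1≤n)))
    (ℚₚ.≤-trans (ℚₚ.≤-reflexive (cong ∣_∣ (trans (cong₂ (λ a c → ι a ℚ.- c) (count≡ n) (sum≡ n)) (ℚₚ.+-inverseʳ (ι n)))))
      (0≤* (ℚₚ.<⇒≤ 0<δ) (subst (0ℚ ℚ.≤_) (sym (sum≡ n)) (0≤ι n))))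
  where
  count≡ : ∀ n → Nω n [] F ≡ n
  count≡ zero    = refl
  count≡ (suc n) = trans (cong (ℕ._+ 1) (count≡ n)) (ℕₚ.+-comm n 1)
  sum≡ : ∀ n → Qsum Q 0 n ≡ ι n
  sum≡ n = trans (Σℚ-const _ 1ℚ n (λ _ _ → refl)) (ℚₚ.*-identityʳ (ι n))

theorem1p15 : (W : BFF) (x : ℕ → Block) → Good W x →
    (Q : BasicSequence) →
    (∀ i n → L W x i ≤ n → n < L W x (suc i) → q Q n ≡ BFF.b W i) →
    (E : ℕ → ℕ) →
    (∀ i → applyUpTo E (L W x i) ≡ word W x i) →
    (∀ n → E n < q Q n) →
    (ξ : ℝ) → cantorTerm Q E sumsTo ξ →
    (∀ k → k ∈R W → NormalOfOrder Q k ξ) ×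
    (BFF.k W ⟶∞ → Normal Q ξ)
theorem1p15 W x good Q levels E digits E<q ξ sums = normal , λ k→∞ k → normal k (inj₂ k→∞)
  where
  open GoodSequence W x good
  normal : ∀ k → k ∈R W → NormalOfOrder Q k ξ
  normal zero    _   = record
    { expandable = λ ()
    ; frequency  = λ { F _ [] → empty-frequency Q F }
    }
  normal (suc k) K∈R = record
    { expandable = λ _ → E , expansion
    -- By uniqueness `F` agrees with `E`, so it has the same prefixes and consists of the same
    -- copies.
    ; frequency  = λ F isF B → Digits.Order.frequency-ratio Q levels F
        (λ i → trans (applyUpTo-cong (CantorSums.expansion-unique Q F E ξ isF expansion) (L W x i)) (digits i)) k K∈R B
    }
    where
    expansion : IsCantorExpansion Q ξ E
    expansion = record
      { digits  = E<q
      ; notLast = Digits.not-last Q levels E digits k K∈R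
      ; value   = sums
      }
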